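{- For every integer $n\ge 34$, $$\max\{f(P(n),M): M\in\mathcal{M}_2(P(n))\}=\left\lceil \frac{n+3}{7}\right\rceil+\delta(n),$$ where $\delta(n)=1$ if $n\equiv 3\pmod 7$, and $\delta(n)=0$ otherwise.
   Context: For $n\ge 3$, $P(n)=P(n,2)$ is the simple graph with vertex set $\{u_i,v_i:0\le i\le n-1\}$ and edge set $\{u_iu_{i+2},\,u_iv_i,\,v_iv_{i+1}:0\le i\le n-1\}$, subscripts modulo $n$. The edges $u_iv_i$ are called spokes. For a perfect matching $M$ of a graph $G$, a forcing set of $M$ is a subset $S\subseteq M$ contained in no perfect matching of $G$ other than $M$; the forcing number $f(G,M)$ is the minimum cardinality of a forcing set of $M$. $\mathcal{M}_2(P(n))$ is the set of perfect matchings $M$ of $P(n)$ such that either (i) $M$ contains at least one spoke, and for any two (cyclically) consecutive spokes $u_iv_i,u_jv_j$ of $M$ the number of spokes $u_kv_k$ of $P(n)$ strictly between them, $j-i-1$ (with $j$ taken as the representative in $(i,i+n]$), is $\equiv 2\pmod 4$ (if $M$ has exactly one spoke $u_iv_i$, it is regarded as two consecutive spokes with $j=i+n$, so the number is $n-1$); or (ii) $M$ contains no spoke, $4\mid n$, and for some $i$, $M=\bigcup_{k=0}^{n/4-1}\{u_{i+4k}u_{i+4k+2},\,u_{i+4k+1}u_{i+4k+3},\,v_{i+4k+1}v_{i+4k+2},\,v_{i+4k+3}v_{i+4k+4}\}$. -}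

module Defs where

open import Data.Bool.Base using (if_then_else_)
open import Data.Fin.Base using (Fin; toℕ; combine; remQuot)
open import Data.Fin.Patterns using (0F; 1F; 2F)
open import Data.Fin.Properties using (nonZeroIndex; toℕ<n; toℕ-injective; toℕ-fromℕ<; combine-remQuot)
open import Data.Fin.Subset using (Subset; _∈_; _∉_; _⊆_; ∣_∣)
open import Data.Nat.Base using (ℕ; _+_; _*_; _∸_; _≤_; _<_; _≡ᵇ_; NonZero; z<s; s<s)
open import Data.Nat.Divisibility using (_∣_)
open import Data.Nat.DivMod
open import Data.Nat.Properties
open import Data.Product using (∃; ∃!; _×_; _,_; proj₁; proj₂; swap)
open import Data.Sum.Base using (_⊎_; inj₁; inj₂)
open import Function.Bundles using (_⇔_)
open import Relation.Binary.PropositionalEquality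
open import Relation.Nullary using (yes; no; contradiction)

IsMinimum IsMaximum : (ℕ → Set) → ℕ → Set
IsMinimum P k = P k × (∀ m → P m → k ≤ m)
IsMaximum P k = P k × (∀ m → P m → m ≤ k)

⌈_/_⌉ : (m d : ℕ) .{{_ : NonZero d}} → ℕ
⌈ m / d ⌉ = (m + (d ∸ 1)) / d

-- Edges are numbered, so that edge sets are library subsets.  The two ends of
-- an edge are listed in an arbitrary order, which nothing below depends on.
record Graph : Set₁ where
  field
    V    : Set
    size : ℕ
    ends : Fin size → V × V

  Edge : Set
  Edge = Fin size

  EdgeSet : Set
  EdgeSet = Subset size

  IsEndOf : V → Edge → Set
  IsEndOf x e = x ≡ proj₁ (ends e) ⊎ x ≡ proj₂ (ends e)

  IsSimple : Set
  IsSimple = (∀ e → proj₁ (ends e) ≢ proj₂ (ends e))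
           × (∀ e e′ → ends e ≡ ends e′ ⊎ ends e ≡ swap (ends e′) → e ≡ e′)

  IsPerfectMatching : EdgeSet → Set
  IsPerfectMatching M = ∀ x → ∃! _≡_ λ e → e ∈ M × IsEndOf x e

  IsForcingSet : EdgeSet → EdgeSet → Set
  IsForcingSet M S =
    S ⊆ M × (∀ M′ → IsPerfectMatching M′ → S ⊆ M′ → M′ ≡ M)

  -- IsForcingNumber M k says f(G, M) = k.
  IsForcingNumber : EdgeSet → ℕ → Set
  IsForcingNumber M =
    IsMinimum λ k → ∃ λ S → IsForcingSet M S × ∣ S ∣ ≡ k

open Graph public

infixl 6 _⊕_

-- Addition of subscripts modulo n.
_⊕_ : ∀ {n} → Fin n → ℕ → Fin n
_⊕_ {n} i k = ((toℕ i + k) mod n) {{nonZeroIndex i}}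

data Vertex (n : ℕ) : Set where
  u v : Fin n → Vertex n

module _ {n : ℕ} where

  -- The edges u_i u_{i+2}, u_i v_i and v_i v_{i+1} respectively.
  uu spoke vv : Fin n → Fin (3 * n)
  uu    = combine {3} 0F
  spoke = combine {3} 1F
  vv    = combine {3} 2F

  endsP : Fin 3 × Fin n → Vertex n × Vertex n
  endsP (0F , i) = u i , u (i ⊕ 2)
  endsP (1F , i) = u i , v i
  endsP (2F , i) = v i , v (i ⊕ 1)

-- The generalized Petersen graph P(n, 2).  For n = 4 this would have parallel
-- edges; for n ≥ 5 it is simple, see P-simple.
P : ℕ → Graph
P n = record { V = Vertex n ; size = 3 * n ; ends = λ e → endsP (remQuot {3} n e) }

module _ (n : ℕ) (M : EdgeSet (P n)) where

  -- The spokes at i and j = i + d are consecutive in M, with d = j - i in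
  -- [1, n]; d = n occurs exactly when M has a single spoke.
  ConsecutiveSpokes : Fin n → ℕ → Set
  ConsecutiveSpokes i d =
    1 ≤ d × d ≤ n × spoke i ∈ M × spoke (i ⊕ d) ∈ M ×
    (∀ c → 1 ≤ c → c < d → spoke (i ⊕ c) ∉ M)

  SpokeGaps≡2mod4 : Set
  SpokeGaps≡2mod4 =
    (∃ λ (i : Fin n) → spoke i ∈ M) × (∀ i d → ConsecutiveSpokes i d → (d ∸ 1) % 4 ≡ 2)

  SpokelessPattern : Set
  SpokelessPattern =
    (∀ (i : Fin n) → spoke i ∉ M) × 4 ∣ n ×
    ∃ λ (i : Fin n) → ∀ (e : Edge (P n)) → e ∈ M ⇔
      (∃ λ k → k < n / 4 ×
        ( e ≡ uu (i ⊕ 4 * k)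
        ⊎ e ≡ uu (i ⊕ (4 * k + 1))
        ⊎ e ≡ vv (i ⊕ (4 * k + 1))
        ⊎ e ≡ vv (i ⊕ (4 * k + 3))))

  𝓜₂ : Set
  𝓜₂ = IsPerfectMatching (P n) M × (SpokeGaps≡2mod4 ⊎ SpokelessPattern)

δ : ℕ → ℕ
δ n = if n % 7 ≡ᵇ 3 then 1 else 0

private

  toℕ-⊕ : ∀ {n} (i : Fin n) k →
          toℕ (i ⊕ k) ≡ ((toℕ i + k) % n) {{nonZeroIndex i}}
  toℕ-⊕ i k = toℕ-fromℕ< _

  ⊕-⊕ : ∀ {n} (i : Fin n) a b → i ⊕ a ⊕ b ≡ i ⊕ (a + b)
  ⊕-⊕ {n} i a b = toℕ-injective (begin
    toℕ (i ⊕ a ⊕ b)                        ≡⟨ toℕ-⊕ (i ⊕ a) b ⟩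
    (toℕ (i ⊕ a) + b) % n                  ≡⟨ cong (λ x → (x + b) % n) (toℕ-⊕ i a) ⟩
    ((toℕ i + a) % n + b) % n              ≡⟨ %-distribˡ-+ ((toℕ i + a) % n) b n ⟩
    ((toℕ i + a) % n % n + b % n) % n      ≡⟨ cong (λ x → (x + b % n) % n) (m%n%n≡m%n (toℕ i + a) n) ⟩
    ((toℕ i + a) % n + b % n) % n          ≡⟨ %-distribˡ-+ (toℕ i + a) b n ⟨
    (toℕ i + a + b) % n                    ≡⟨ cong (_% n) (+-assoc (toℕ i) a b) ⟩
    (toℕ i + (a + b)) % n                  ≡⟨ toℕ-⊕ i (a + b) ⟨
    toℕ (i ⊕ (a + b))                      ∎)
    where
    open ≡-Reasoning
    instance
      nz : NonZero n
      nz = nonZeroIndex i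

  ⊕-≢ : ∀ {n} (i : Fin n) {k} → 0 < k → k < n → i ⊕ k ≢ i
  ⊕-≢ {n} i {k} 0<k k<n i⊕k≡i with toℕ i + k <? n
  ... | yes i+k<n = <⇒≢ 0<k (sym (m+n≡m⇒n≡0 (toℕ i) (trans (sym (m<n⇒m%n≡m i+k<n)) eq)))
    where
    instance
      nz : NonZero n
      nz = nonZeroIndex i
    eq : (toℕ i + k) % n ≡ toℕ i
    eq = trans (sym (toℕ-⊕ i k)) (cong toℕ i⊕k≡i)
    m+n≡m⇒n≡0 : ∀ m {n} → m + n ≡ m → n ≡ 0
    m+n≡m⇒n≡0 m p = +-cancelˡ-≡ m _ _ (trans p (sym (+-identityʳ m)))
  ... | no i+k≮n = <⇒≢ k<n (+-cancelˡ-≡ (toℕ i) k n i+k≡i+n)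
    where
    instance
      nz : NonZero n
      nz = nonZeroIndex i
    n≤i+k : n ≤ toℕ i + k
    n≤i+k = ≮⇒≥ i+k≮n
    small : toℕ i + k ∸ n < n
    small = m<n+o⇒m∸n<o (toℕ i + k) n (+-mono-< (toℕ<n i) k<n)
    eq : toℕ i + k ∸ n ≡ toℕ i
    eq = begin
      toℕ i + k ∸ n        ≡⟨ m<n⇒m%n≡m small ⟨
      (toℕ i + k ∸ n) % n  ≡⟨ m≤n⇒[n∸m]%m≡n%m n≤i+k ⟩
      (toℕ i + k) % n      ≡⟨ toℕ-⊕ i k ⟨
      toℕ (i ⊕ k)          ≡⟨ cong toℕ i⊕k≡i ⟩
      toℕ i                ∎
      where open ≡-Reasoning
    i+k≡i+n : toℕ i + k ≡ toℕ i + n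
    i+k≡i+n = trans (sym (m∸n+n≡m n≤i+k)) (cong (_+ n) eq)

  u-inj : ∀ {n} {i j : Fin n} → u i ≡ u j → i ≡ j
  u-inj refl = refl

  v-inj : ∀ {n} {i j : Fin n} → v i ≡ v j → i ≡ j
  v-inj refl = refl

  no-swap : ∀ {n} {i j : Fin n} a → 0 < a + a → a + a < n →
            i ≡ j ⊕ a → i ⊕ a ≢ j
  no-swap {j = j} a 0<2a 2a<n refl q = ⊕-≢ j 0<2a 2a<n (trans (sym (⊕-⊕ j a a)) q)

  endsP-distinct : ∀ {n} → 5 ≤ n → ∀ a → proj₁ (endsP {n} a) ≢ proj₂ (endsP a)
  endsP-distinct 5≤n (0F , i) p =
    ⊕-≢ i z<s (≤-trans (s<s (s<s z<s)) 5≤n) (sym (u-inj p))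
  endsP-distinct 5≤n (1F , i) ()
  endsP-distinct 5≤n (2F , i) p =
    ⊕-≢ i z<s (≤-trans (s<s z<s) 5≤n) (sym (v-inj p))

  endsP-injective : ∀ {n} → 5 ≤ n → ∀ a b →
    endsP {n} a ≡ endsP b ⊎ endsP a ≡ swap (endsP b) → a ≡ b
  endsP-injective 5≤n (0F , i) (0F , j) (inj₁ p) = cong (0F ,_) (u-inj (cong proj₁ p))
  endsP-injective 5≤n (0F , i) (0F , j) (inj₂ p) = contradiction (u-inj (cong proj₂ p))
    (no-swap 2 z<s 5≤n (u-inj (cong proj₁ p)))
  endsP-injective 5≤n (1F , i) (1F , j) (inj₁ p) = cong (1F ,_) (u-inj (cong proj₁ p))
  endsP-injective 5≤n (2F , i) (2F , j) (inj₁ p) = cong (2F ,_) (v-inj (cong proj₁ p))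
  endsP-injective 5≤n (2F , i) (2F , j) (inj₂ p) = contradiction (v-inj (cong proj₂ p))
    (no-swap 1 z<s (≤-trans (s<s (s<s z<s)) 5≤n) (v-inj (cong proj₁ p)))
  endsP-injective 5≤n (0F , i) (1F , j) (inj₁ ())
  endsP-injective 5≤n (0F , i) (1F , j) (inj₂ ())
  endsP-injective 5≤n (0F , i) (2F , j) (inj₁ ())
  endsP-injective 5≤n (0F , i) (2F , j) (inj₂ ())
  endsP-injective 5≤n (1F , i) (0F , j) (inj₁ ())
  endsP-injective 5≤n (1F , i) (0F , j) (inj₂ ())
  endsP-injective 5≤n (1F , i) (1F , j) (inj₂ ())
  endsP-injective 5≤n (1F , i) (2F , j) (inj₁ ())
  endsP-injective 5≤n (1F , i) (2F , j) (inj₂ ())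
  endsP-injective 5≤n (2F , i) (0F , j) (inj₁ ())
  endsP-injective 5≤n (2F , i) (0F , j) (inj₂ ())
  endsP-injective 5≤n (2F , i) (1F , j) (inj₁ ())
  endsP-injective 5≤n (2F , i) (1F , j) (inj₂ ())

P-simple : ∀ n → 5 ≤ n → IsSimple (P n)
P-simple n 5≤n =
  (λ e → endsP-distinct 5≤n (remQuot {3} n e)) ,
  (λ e e′ p → trans (sym (combine-remQuot {3} n e))
    (trans (cong (λ a → combine (proj₁ a) (proj₂ a))
             (endsP-injective 5≤n (remQuot {3} n e) (remQuot {3} n e′) p))
           (combine-remQuot {3} n e′)))

{-# OPTIONS --safe #-}

module Submission where

{- Reading off, for i = 0, 1, 2, …, which of the edges u_i u_{i+2}, u_i v_i and
v_i v_{i+1} it contains turns a perfect matching of P(n) into a closed walk of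
length n on eight states.  The matchings in 𝓜₂ are the closed walks through one
state, home.  From home all steps are forced until it is reached again, either
after three steps, the first with a spoke (letter A), or after four steps without
a spoke (letter L): so 𝓜₂ consists of cyclic words in A and L, and a set S of
edges of such a word is forcing if no other closed walk contains S.

Upper bound.  Begin the word with an A and choose its spoke.  A competing closed
walk then starts at home or at one further state, origin, and it suffices to
follow the set of states which such walks can have reached.  Choosing at most one
edge per letter, an automaton with eight nodes keeps this set under control, and a
potential argument bounds the number c of chosen edges by 7 c ≤ n + 9 or
7 c = n + 11.  Words without A are treated by hand.

Lower bound.  For suitable words t (LA)^q, the pairs of states joined by competing
walks, minimised over all choices of edges with a given number of elements, repeat
themselves after every further LA, at the cost of one more edge. -}

open import Data.Bool.Base using (Bool; true; false; not; _∧_; _∨_; _xor_; T; if_then_else_)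
open import Data.Bool.ListAction using (any; all)
open import Data.Bool.Properties using (T-∧; T-∨; T-≡; T?; not-involutive)
open import Data.Empty using (⊥-elim)
open import Data.Fin.Base using (Fin; toℕ; combine; remQuot; _↑ˡ_; _↑ʳ_) renaming (zero to fzero; suc to fsuc)
open import Data.Fin.Patterns using (0F; 1F; 2F)
open import Data.Fin.Properties using (toℕ<n; toℕ-injective; toℕ-fromℕ<; remQuot-combine; combine-remQuot; combine-injective)
open import Data.Fin.Subset using (Subset; _⊆_; ∣_∣) renaming (_∈_ to _∈ˢ_; _∉_ to _∉ˢ_)
open import Data.Fin.Subset.Properties using (⊆-antisym)
open import Data.List.Base using (List; []; _∷_; _++_; [_]; _∷ʳ_; map; concatMap; filterᵇ; foldr; reverse; length; replicate)
open import Data.List.Membership.Propositional using (_∈_; find; lose)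
open import Data.List.Membership.Propositional.Properties using (∈-filter⁺)
open import Data.List.Properties using (map-++; ++-identityʳ; ++-assoc; length-++; ∷-injectiveˡ; ∷-injectiveʳ; ∷ʳ-injectiveˡ; ∷ʳ-injectiveʳ)
open import Data.List.Relation.Binary.Pointwise as Pointwise using (Pointwise; []; _∷_)
open import Data.List.Relation.Unary.All as All using (All; []; _∷_)
import Data.List.Relation.Unary.All.Properties as All
open import Data.List.Relation.Unary.Any as Any using (Any; here; there)
import Data.List.Relation.Unary.Any.Properties as Any
open import Data.Nat.Base using (ℕ; zero; suc; pred; _+_; _*_; _∸_; _/_; _%_; _≤_; _<_; _≤ᵇ_; ⌊_/2⌋; NonZero; >-nonZero; z≤n; s≤s; z<s; s<s)
open import Data.Nat.DivMod using (_mod_; m/n≡1+[m∸n]/n; m≥n⇒m/n>0; m≡m%n+[m/n]*n; m%n<n; m%n%n≡m%n; m*n%n≡0; m<n⇒m%n≡m; %-distribˡ-+; [m+kn]%n≡m%n)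
open import Data.Nat.ListAction using (sum)
open import Data.Nat.ListAction.Properties using (sum-++)
open import Data.Nat.Properties
open import Data.Nat.Tactic.RingSolver using (solve-∀)
open import Data.Product using (∃; ∃!; ∃₂; Σ; _×_; _,_; proj₁; proj₂)
open import Data.Sum.Base using (_⊎_; inj₁; inj₂)
open import Data.Vec.Base using ([]; _∷_; lookup; tabulate)
open import Data.Vec.Properties using ([]=⇒lookup; lookup⇒[]=; lookup∘tabulate)
open import Defs
open import Function.Base using (_∘_; case_of_)
open import Function.Bundles using (module Equivalence)
open import Relation.Binary.PropositionalEquality hiding ([_])
open import Relation.Nullary using (¬_; yes; no; contradiction)

open Equivalence using (to; from)

-- Walks

pattern ○ = false
pattern ● = true

-- Whether a matching contains u_i u_{i+2}, u_i v_i and v_i v_{i+1}.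
record Label : Set where
  constructor ⟨_,_,_⟩
  field
    hop rung rim : Bool

open Label public

-- Whether a matching contains u_{i-2} u_i, u_{i-1} u_{i+1} and v_{i-1} v_i.
record State : Set where
  constructor ⟪_,_,_⟫
  field
    hop₂ hop₁ rim₁ : Bool

data One : Bool → Bool → Bool → Set where
  one₁ : One ● ○ ○
  one₂ : One ○ ● ○
  one₃ : One ○ ○ ●

-- The two conditions belong to the vertices u_i and v_i: each is covered by exactly one of its
-- three edges.
Legal : State → Label → Set
Legal ⟪ p , q , r ⟫ ⟨ a , s , b ⟩ = One p a s × One r b s

next : State → Label → State
next ⟪ p , q , r ⟫ ⟨ a , s , b ⟩ = ⟪ q , a , b ⟫

data Walk : State → List Label → State → Set where
  []  : ∀ {x} → Walk x [] x
  _∷_ : ∀ {x t ts y} → Legal x t → Walk (next x t) ts y → Walk x (t ∷ ts) y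

infix 4 _⇒ᵇ_ _==ᵇ_ _==_ _⊑ᵇ_ _⊑_ _⊑*_ _∋_ _⊆ᵇ_
infixr 6 _∪_

_⇒ᵇ_ _==ᵇ_ : Bool → Bool → Bool
○ ⇒ᵇ b = ●
● ⇒ᵇ b = b
○ ==ᵇ b = not b
● ==ᵇ b = b

_==_ : State → State → Bool
⟪ p , q , r ⟫ == ⟪ p′ , q′ , r′ ⟫ = (p ==ᵇ p′) ∧ (q ==ᵇ q′) ∧ (r ==ᵇ r′)

_⊑ᵇ_ : Label → Label → Bool
⟨ a , s , b ⟩ ⊑ᵇ ⟨ a′ , s′ , b′ ⟩ = (a ⇒ᵇ a′) ∧ (s ⇒ᵇ s′) ∧ (b ⇒ᵇ b′)

_⊑_ : Label → Label → Set
o ⊑ t = T (o ⊑ᵇ t)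

_⊑*_ : List Label → List Label → Set
_⊑*_ = Pointwise _⊑_

bit : Bool → ℕ
bit ○ = 0
bit ● = 1

weight : Label → ℕ
weight ⟨ a , s , b ⟩ = bit a + (bit s + bit b)

cost : List Label → ℕ
cost os = sum (map weight os)

cost-++ : ∀ os os′ → cost (os ++ os′) ≡ cost os + cost os′
cost-++ os os′ = trans (cong sum (map-++ weight os os′)) (sum-++ (map weight os) _)

walk-++ : ∀ {x y z ts us} → Walk x ts y → Walk y us z → Walk x (ts ++ us) z
walk-++ []      w = w
walk-++ (l ∷ σ) w = l ∷ walk-++ σ w

walk-end-unique : ∀ {x y z ts} → Walk x ts y → Walk x ts z → y ≡ z
walk-end-unique []      []      = refl
walk-end-unique (_ ∷ σ) (_ ∷ w) = walk-end-unique σ w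

⊑*-split : ∀ os {os′ ts x y} → os ++ os′ ⊑* ts → Walk x ts y →
  ∃₂ λ us vs → ∃ λ z → ts ≡ us ++ vs × os ⊑* us × os′ ⊑* vs × Walk x us z × Walk z vs y
⊑*-split []       p       w       = [] , _ , _ , refl , [] , p , [] , w
⊑*-split (o ∷ os) (q ∷ p) (l ∷ w) with us , vs , z , refl , p₁ , p₂ , w₁ , w₂ ← ⊑*-split os p w =
  _ ∷ us , vs , z , refl , q ∷ p₁ , p₂ , l ∷ w₁ , w₂

==ᵇ-sound : ∀ a b → T (a ==ᵇ b) → a ≡ b
==ᵇ-sound ○ ○ _ = refl
==ᵇ-sound ● ● _ = refl

==-sound : ∀ x y → T (x == y) → x ≡ y
==-sound ⟪ p , q , r ⟫ ⟪ p′ , q′ , r′ ⟫ e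
  with e₁ , e ← to (T-∧ {p ==ᵇ p′}) e
  with e₂ , e₃ ← to (T-∧ {q ==ᵇ q′}) e
  rewrite ==ᵇ-sound p p′ e₁ | ==ᵇ-sound q q′ e₂ | ==ᵇ-sound r r′ e₃ = refl

one-unique : ∀ {p a s s′} → One p a s → One p a s′ → s ≡ s′
one-unique one₁ one₁ = refl
one-unique one₂ one₂ = refl
one-unique one₃ one₃ = refl

-- The new state shows the hop and the rim of the label, and the condition at u_i then decides the
-- rung. Hence two walks that part must at once be in different states.
next-injective : ∀ {x l t} → Legal x l → Legal x t → next x l ≡ next x t → l ≡ t
next-injective {⟪ p , q , r ⟫} {⟨ a , s , b ⟩} {⟨ _ , s′ , _ ⟩} (i , _) (j , _) refl =
  cong (λ z → ⟨ a , z , b ⟩) (one-unique i j)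

-- Eight bits, indexed by the three components of a state, so that inclusions between concrete sets
-- are settled by evaluation.
data States : Set where
  states : (b₀₀₀ b₀₀₁ b₀₁₀ b₀₁₁ b₁₀₀ b₁₀₁ b₁₁₀ b₁₁₁ : Bool) → States

at : States → State → Bool
at (states b₀ b₁ b₂ b₃ b₄ b₅ b₆ b₇) ⟪ ○ , ○ , ○ ⟫ = b₀
at (states b₀ b₁ b₂ b₃ b₄ b₅ b₆ b₇) ⟪ ○ , ○ , ● ⟫ = b₁
at (states b₀ b₁ b₂ b₃ b₄ b₅ b₆ b₇) ⟪ ○ , ● , ○ ⟫ = b₂
at (states b₀ b₁ b₂ b₃ b₄ b₅ b₆ b₇) ⟪ ○ , ● , ● ⟫ = b₃
at (states b₀ b₁ b₂ b₃ b₄ b₅ b₆ b₇) ⟪ ● , ○ , ○ ⟫ = b₄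
at (states b₀ b₁ b₂ b₃ b₄ b₅ b₆ b₇) ⟪ ● , ○ , ● ⟫ = b₅
at (states b₀ b₁ b₂ b₃ b₄ b₅ b₆ b₇) ⟪ ● , ● , ○ ⟫ = b₆
at (states b₀ b₁ b₂ b₃ b₄ b₅ b₆ b₇) ⟪ ● , ● , ● ⟫ = b₇

_∋_ : States → State → Set
X ∋ x = T (at X x)

comprehend : (State → Bool) → States
comprehend f = states
  (f ⟪ ○ , ○ , ○ ⟫) (f ⟪ ○ , ○ , ● ⟫) (f ⟪ ○ , ● , ○ ⟫) (f ⟪ ○ , ● , ● ⟫)
  (f ⟪ ● , ○ , ○ ⟫) (f ⟪ ● , ○ , ● ⟫) (f ⟪ ● , ● , ○ ⟫) (f ⟪ ● , ● , ● ⟫)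

at-comprehend : ∀ f x → at (comprehend f) x ≡ f x
at-comprehend f ⟪ ○ , ○ , ○ ⟫ = refl
at-comprehend f ⟪ ○ , ○ , ● ⟫ = refl
at-comprehend f ⟪ ○ , ● , ○ ⟫ = refl
at-comprehend f ⟪ ○ , ● , ● ⟫ = refl
at-comprehend f ⟪ ● , ○ , ○ ⟫ = refl
at-comprehend f ⟪ ● , ○ , ● ⟫ = refl
at-comprehend f ⟪ ● , ● , ○ ⟫ = refl
at-comprehend f ⟪ ● , ● , ● ⟫ = refl

∅ : States
∅ = comprehend λ _ → ○

｛_｝ : State → States
｛ x ｝ = comprehend (x ==_)

_∪_ : States → States → States
states a₀ a₁ a₂ a₃ a₄ a₅ a₆ a₇ ∪ states b₀ b₁ b₂ b₃ b₄ b₅ b₆ b₇ = states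
  (a₀ ∨ b₀) (a₁ ∨ b₁) (a₂ ∨ b₂) (a₃ ∨ b₃) (a₄ ∨ b₄) (a₅ ∨ b₅) (a₆ ∨ b₆) (a₇ ∨ b₇)

at-∪ : ∀ X Y x → at (X ∪ Y) x ≡ at X x ∨ at Y x
at-∪ (states _ _ _ _ _ _ _ _) (states _ _ _ _ _ _ _ _) ⟪ ○ , ○ , ○ ⟫ = refl
at-∪ (states _ _ _ _ _ _ _ _) (states _ _ _ _ _ _ _ _) ⟪ ○ , ○ , ● ⟫ = refl
at-∪ (states _ _ _ _ _ _ _ _) (states _ _ _ _ _ _ _ _) ⟪ ○ , ● , ○ ⟫ = refl
at-∪ (states _ _ _ _ _ _ _ _) (states _ _ _ _ _ _ _ _) ⟪ ○ , ● , ● ⟫ = refl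
at-∪ (states _ _ _ _ _ _ _ _) (states _ _ _ _ _ _ _ _) ⟪ ● , ○ , ○ ⟫ = refl
at-∪ (states _ _ _ _ _ _ _ _) (states _ _ _ _ _ _ _ _) ⟪ ● , ○ , ● ⟫ = refl
at-∪ (states _ _ _ _ _ _ _ _) (states _ _ _ _ _ _ _ _) ⟪ ● , ● , ○ ⟫ = refl
at-∪ (states _ _ _ _ _ _ _ _) (states _ _ _ _ _ _ _ _) ⟪ ● , ● , ● ⟫ = refl

_⊆ᵇ_ : States → States → Bool
states a₀ a₁ a₂ a₃ a₄ a₅ a₆ a₇ ⊆ᵇ states b₀ b₁ b₂ b₃ b₄ b₅ b₆ b₇ =
  (a₀ ⇒ᵇ b₀) ∧ (a₁ ⇒ᵇ b₁) ∧ (a₂ ⇒ᵇ b₂) ∧ (a₃ ⇒ᵇ b₃) ∧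
  (a₄ ⇒ᵇ b₄) ∧ (a₅ ⇒ᵇ b₅) ∧ (a₆ ⇒ᵇ b₆) ∧ (a₇ ⇒ᵇ b₇)

⇒ᵇ-elim : ∀ {a b} → T (a ⇒ᵇ b) → T a → T b
⇒ᵇ-elim {●} e _ = e

⊆ᵇ-sound : ∀ X Y → T (X ⊆ᵇ Y) → ∀ x → X ∋ x → Y ∋ x
⊆ᵇ-sound (states a₀ a₁ a₂ a₃ a₄ a₅ a₆ a₇) (states b₀ b₁ b₂ b₃ b₄ b₅ b₆ b₇) r
  with e₀ , r ← to (T-∧ {a₀ ⇒ᵇ b₀}) r
  with e₁ , r ← to (T-∧ {a₁ ⇒ᵇ b₁}) r
  with e₂ , r ← to (T-∧ {a₂ ⇒ᵇ b₂}) r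
  with e₃ , r ← to (T-∧ {a₃ ⇒ᵇ b₃}) r
  with e₄ , r ← to (T-∧ {a₄ ⇒ᵇ b₄}) r
  with e₅ , r ← to (T-∧ {a₅ ⇒ᵇ b₅}) r
  with e₆ , e₇ ← to (T-∧ {a₆ ⇒ᵇ b₆}) r
  = λ where
    ⟪ ○ , ○ , ○ ⟫ → ⇒ᵇ-elim e₀
    ⟪ ○ , ○ , ● ⟫ → ⇒ᵇ-elim e₁
    ⟪ ○ , ● , ○ ⟫ → ⇒ᵇ-elim e₂
    ⟪ ○ , ● , ● ⟫ → ⇒ᵇ-elim e₃
    ⟪ ● , ○ , ○ ⟫ → ⇒ᵇ-elim e₄
    ⟪ ● , ○ , ● ⟫ → ⇒ᵇ-elim e₅
    ⟪ ● , ● , ○ ⟫ → ⇒ᵇ-elim e₆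
    ⟪ ● , ● , ● ⟫ → ⇒ᵇ-elim e₇

-- A state ⟪ q , a , b ⟫ is entered from ⟪ not a , q , not b ⟫ without a spoke and,
-- if a and b are false, also from ⟪ ○ , q , ○ ⟫ through a spoke.
advance : Label → States → States
advance o (states b₀ b₁ b₂ b₃ b₄ b₅ b₆ b₇) = states
  (b₅ ∧ empty ∨ b₀ ∧ spoke?) (b₄ ∧ vv?) (b₁ ∧ uu?) (b₀ ∧ both?)
  (b₇ ∧ empty ∨ b₂ ∧ spoke?) (b₆ ∧ vv?) (b₃ ∧ uu?) (b₂ ∧ both?)
  where
  empty  = o ⊑ᵇ ⟨ ○ , ○ , ○ ⟩
  spoke? = o ⊑ᵇ ⟨ ○ , ● , ○ ⟩
  vv?    = o ⊑ᵇ ⟨ ○ , ○ , ● ⟩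
  uu?    = o ⊑ᵇ ⟨ ● , ○ , ○ ⟩
  both?  = o ⊑ᵇ ⟨ ● , ○ , ● ⟩

advance⁺ : ∀ X {x o l} → X ∋ x → Legal x l → o ⊑ l → advance o X ∋ next x l
advance⁺ (states _ _ _ _ _ _ _ _) {⟪ _ , ○ , _ ⟫} h (one₁ , one₁) s = from T-∨ (inj₁ (from T-∧ (h , s)))
advance⁺ (states _ _ _ _ _ _ _ _) {⟪ _ , ● , _ ⟫} h (one₁ , one₁) s = from T-∨ (inj₁ (from T-∧ (h , s)))
advance⁺ (states _ _ _ _ _ _ _ _) {⟪ _ , ○ , _ ⟫} h (one₁ , one₂) s = from T-∧ (h , s)
advance⁺ (states _ _ _ _ _ _ _ _) {⟪ _ , ● , _ ⟫} h (one₁ , one₂) s = from T-∧ (h , s)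
advance⁺ (states b _ _ _ _ c _ _) {⟪ _ , ○ , _ ⟫} {o} h (one₃ , one₃) s = from (T-∨ {c ∧ (o ⊑ᵇ _)}) (inj₂ (from T-∧ (h , s)))
advance⁺ (states _ _ b _ _ _ _ c) {⟪ _ , ● , _ ⟫} {o} h (one₃ , one₃) s = from (T-∨ {c ∧ (o ⊑ᵇ _)}) (inj₂ (from T-∧ (h , s)))
advance⁺ (states _ _ _ _ _ _ _ _) {⟪ _ , ○ , _ ⟫} h (one₂ , one₁) s = from T-∧ (h , s)
advance⁺ (states _ _ _ _ _ _ _ _) {⟪ _ , ● , _ ⟫} h (one₂ , one₁) s = from T-∧ (h , s)
advance⁺ (states _ _ _ _ _ _ _ _) {⟪ _ , ○ , _ ⟫} h (one₂ , one₂) s = from T-∧ (h , s)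
advance⁺ (states _ _ _ _ _ _ _ _) {⟪ _ , ● , _ ⟫} h (one₂ , one₂) s = from T-∧ (h , s)

Step : Label → State → State → Set
Step o x y = ∃ λ l → Legal x l × o ⊑ l × next x l ≡ y

advance⁻ : ∀ X {o} y → advance o X ∋ y → ∃ λ x → X ∋ x × Step o x y
advance⁻ (states b₀ b₁ b₂ b₃ b₄ b₅ b₆ b₇) {o} ⟪ ○ , ○ , ○ ⟫ h with to (T-∨ {b₅ ∧ (o ⊑ᵇ _)}) h
... | inj₁ h with e , s ← to (T-∧ {b₅}) h = ⟪ ● , ○ , ● ⟫ , e , _ , (one₁ , one₁) , s , refl
... | inj₂ h with e , s ← to (T-∧ {b₀}) h = ⟪ ○ , ○ , ○ ⟫ , e , _ , (one₃ , one₃) , s , refl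
advance⁻ (states b₀ b₁ b₂ b₃ b₄ b₅ b₆ b₇) {o} ⟪ ● , ○ , ○ ⟫ h with to (T-∨ {b₇ ∧ (o ⊑ᵇ _)}) h
... | inj₁ h with e , s ← to (T-∧ {b₇}) h = ⟪ ● , ● , ● ⟫ , e , _ , (one₁ , one₁) , s , refl
... | inj₂ h with e , s ← to (T-∧ {b₂}) h = ⟪ ○ , ● , ○ ⟫ , e , _ , (one₃ , one₃) , s , refl
advance⁻ (states b₀ b₁ b₂ b₃ b₄ b₅ b₆ b₇) ⟪ ○ , ○ , ● ⟫ h with e , s ← to (T-∧ {b₄}) h =
  ⟪ ● , ○ , ○ ⟫ , e , _ , (one₁ , one₂) , s , refl
advance⁻ (states b₀ b₁ b₂ b₃ b₄ b₅ b₆ b₇) ⟪ ○ , ● , ○ ⟫ h with e , s ← to (T-∧ {b₁}) h =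
  ⟪ ○ , ○ , ● ⟫ , e , _ , (one₂ , one₁) , s , refl
advance⁻ (states b₀ b₁ b₂ b₃ b₄ b₅ b₆ b₇) ⟪ ○ , ● , ● ⟫ h with e , s ← to (T-∧ {b₀}) h =
  ⟪ ○ , ○ , ○ ⟫ , e , _ , (one₂ , one₂) , s , refl
advance⁻ (states b₀ b₁ b₂ b₃ b₄ b₅ b₆ b₇) ⟪ ● , ○ , ● ⟫ h with e , s ← to (T-∧ {b₆}) h =
  ⟪ ● , ● , ○ ⟫ , e , _ , (one₁ , one₂) , s , refl
advance⁻ (states b₀ b₁ b₂ b₃ b₄ b₅ b₆ b₇) ⟪ ● , ● , ○ ⟫ h with e , s ← to (T-∧ {b₃}) h =
  ⟪ ○ , ● , ● ⟫ , e , _ , (one₂ , one₁) , s , refl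
advance⁻ (states b₀ b₁ b₂ b₃ b₄ b₅ b₆ b₇) ⟪ ● , ● , ● ⟫ h with e , s ← to (T-∧ {b₂}) h =
  ⟪ ○ , ● , ○ ⟫ , e , _ , (one₂ , one₂) , s , refl

astray : State → Label → Label → State → Bool
astray x t o y = at (advance o ｛ x ｝) y ∧ not (y == next x t)

-- As advance o X, together with the states reached by leaving a given walk,
-- which is at x and continues with t.
deviate : State → Label → Label → States → States
deviate x t o X = advance o X ∪ comprehend (astray x t o)

｛｝∋ : ∀ x → ｛ x ｝ ∋ x
｛｝∋ ⟪ ○ , ○ , ○ ⟫ = _
｛｝∋ ⟪ ○ , ○ , ● ⟫ = _
｛｝∋ ⟪ ○ , ● , ○ ⟫ = _
｛｝∋ ⟪ ○ , ● , ● ⟫ = _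
｛｝∋ ⟪ ● , ○ , ○ ⟫ = _
｛｝∋ ⟪ ● , ○ , ● ⟫ = _
｛｝∋ ⟪ ● , ● , ○ ⟫ = _
｛｝∋ ⟪ ● , ● , ● ⟫ = _

｛｝⁻ : ∀ x {y} → ｛ x ｝ ∋ y → x ≡ y
｛｝⁻ x {y} h = ==-sound x y (subst T (at-comprehend (x ==_) y) h)

==-refl : ∀ x → T (x == x)
==-refl x = subst T (at-comprehend (x ==_) x) (｛｝∋ x)

T-not : ∀ {b} → ¬ T b → T (not b)
T-not {○} _ = _
T-not {●} f = ⊥-elim (f _)

not-T : ∀ {b} → T (not b) → ¬ T b
not-T {○} _ ()

deviate-old : ∀ x t o X {y} → advance o X ∋ y → deviate x t o X ∋ y
deviate-old x t o X {y} h =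
  subst T (sym (at-∪ (advance o X) (comprehend (astray x t o)) y)) (from T-∨ (inj₁ h))

deviate-new : ∀ x t o {l} X → Legal x t → Legal x l → o ⊑ l → l ≢ t → deviate x t o X ∋ next x l
deviate-new x t o {l} X i j s ne =
  subst T (sym (at-∪ (advance o X) (comprehend (astray x t o)) y))
    (from (T-∨ {at (advance o X) y}) (inj₂ (subst T (sym (at-comprehend (astray x t o) y))
      (from (T-∧ {at (advance o ｛ x ｝) y} {not (y == next x t)})
        (advance⁺ ｛ x ｝ {o = o} (｛｝∋ x) j s ,
         T-not {y == next x t} λ e → ne (next-injective j i (==-sound y (next x t) e)))))))
  where y = next x l

deviate⁻ : ∀ x t o X y → deviate x t o X ∋ y →
  advance o X ∋ y ⊎ Step o x y × y ≢ next x t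
deviate⁻ x t o X y h
  with to (T-∨ {at (advance o X) y}) (subst T (at-∪ (advance o X) (comprehend (astray x t o)) y) h)
... | inj₁ h = inj₁ h
... | inj₂ h
  with h , ne ← to (T-∧ {at (advance o ｛ x ｝) y}) (subst T (at-comprehend (astray x t o) y) h)
  with x′ , e , st ← advance⁻ ｛ x ｝ {o} y h
  with refl ← ｛｝⁻ x {x′} e = inj₂ (st , λ { refl → not-T {y == y} ne (==-refl y) })

-- Words in the letters A and L

data Letter : Set where
  A L : Letter

labels : Letter → List Label
labels A = ⟨ ○ , ● , ○ ⟩ ∷ ⟨ ○ , ○ , ● ⟩ ∷ ⟨ ● , ○ , ○ ⟩ ∷ []
labels L = ⟨ ● , ○ , ● ⟩ ∷ ⟨ ○ , ○ , ○ ⟩ ∷ ⟨ ○ , ○ , ● ⟩ ∷ ⟨ ● , ○ , ○ ⟩ ∷ []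

Word : Set
Word = List Letter

flatten : Word → List Label
flatten = concatMap labels

flatten-++ : ∀ w w′ → flatten (w ++ w′) ≡ flatten w ++ flatten w′
flatten-++ []      w′ = refl
flatten-++ (l ∷ w) w′ = trans (cong (labels l ++_) (flatten-++ w w′)) (sym (++-assoc (labels l) _ _))

home origin : State
home   = ⟪ ○ , ● , ○ ⟫
origin = ⟪ ○ , ○ , ○ ⟫

labels-walk : ∀ l → Walk home (labels l) home
labels-walk A = (one₃ , one₃) ∷ (one₁ , one₂) ∷ (one₂ , one₁) ∷ []
labels-walk L = (one₂ , one₂) ∷ (one₁ , one₁) ∷ (one₁ , one₂) ∷ (one₂ , one₁) ∷ []

flatten-walk : ∀ w → Walk home (flatten w) home
flatten-walk []      = []
flatten-walk (l ∷ w) = walk-++ (labels-walk l) (flatten-walk w)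

-- From home every step is forced until home is reached again.
parse : ∀ {ts} → Walk home ts home → ∃ λ w → ts ≡ flatten w
parse [] = [] , refl
parse ((one₃ , one₃) ∷ (one₁ , one₂) ∷ (one₂ , one₁) ∷ σ) with w , refl ← parse σ = A ∷ w , refl
parse ((one₂ , one₂) ∷ (one₁ , one₁) ∷ (one₁ , one₂) ∷ (one₂ , one₁) ∷ σ) with w , refl ← parse σ = L ∷ w , refl

-- Closed walks stand for perfect matchings wherever they start, so `x` is not restricted to `home`.
Forces : List Label → List Label → Set
Forces ts os = ∀ x ts′ → Walk x ts′ x → os ⊑* ts′ → ts′ ≡ ts

-- The upper bound for words

run : State → List Label → List Label → States → States
run x (t ∷ ts) (o ∷ os) X = run (next x t) ts os (deviate x t o X)
run x _        _        X = X

run-old : ∀ {x ts os y z us} X → os ⊑* ts → X ∋ y → Walk y us z → os ⊑* us → run x ts os X ∋ z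
run-old X []      h []      []      = h
run-old {x} {t ∷ _} {o ∷ _} X (_ ∷ p) h (l ∷ w) (s ∷ q) =
  run-old _ p (deviate-old x t o X (advance⁺ X {o = o} h l s)) w q

-- At the first label where `us` differs from `ts`, the state reached is among those added by
-- `deviate`; from there on `run-old` applies.
run-new : ∀ {x ts os y z us} X → os ⊑* ts → Walk x ts y → Walk x us z → os ⊑* us →
  us ≡ ts ⊎ run x ts os X ∋ z
run-new X [] [] [] [] = inj₁ refl
run-new {x} {t ∷ ts} {o ∷ os} {us = t′ ∷ _} X (_ ∷ p) (i ∷ σ) (j ∷ w) (s ∷ q) with T? (next x t′ == next x t)
... | no ne = inj₂ (run-old _ p
  (deviate-new x t o X i j s (λ { refl → ne (==-refl (next x t)) })) w q)
... | yes e with refl ← next-injective {x} j i (==-sound (next x t′) (next x t) e) with run-new (deviate x t o X) p σ w q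
... | inj₁ refl = inj₁ refl
... | inj₂ h    = inj₂ h

-- A choice of edges of w which confines to Y the end of any walk containing
-- them, if the walk starts in X or leaves the walk of w.
record Plan (w : Word) (X Y : States) (c : ℕ) : Set where
  field
    chosen : List Label
    below  : chosen ⊑* flatten w
    price  : cost chosen ≤ c
    old    : ∀ {x y ts} → X ∋ x → Walk x ts y → chosen ⊑* ts → Y ∋ y
    new    : ∀ {y ts} → Walk home ts y → chosen ⊑* ts → ts ≡ flatten w ⊎ Y ∋ y

open Plan

plan-letter : ∀ l {os X Y} → os ⊑* labels l → T (run home (labels l) os X ⊆ᵇ Y) → Plan [ l ] X Y (cost os)
plan-letter l {os} {X} {Y} p r = record
  { chosen = os
  ; below  = subst (os ⊑*_) (sym (++-identityʳ (labels l))) p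
  ; price  = ≤-refl
  ; old    = λ h σ q → ⊆ᵇ-sound (run home (labels l) os X) Y r _ (run-old X p h σ q)
  ; new    = λ σ q → case run-new X p (labels-walk l) σ q of λ where
      (inj₁ e) → inj₁ (trans e (sym (++-identityʳ (labels l))))
      (inj₂ h) → inj₂ (⊆ᵇ-sound (run home (labels l) os X) Y r _ h)
  }

plan-++ : ∀ {w w′ X Y Z c c′} → Plan w X Y c → Plan w′ Y Z c′ → Plan (w ++ w′) X Z (c + c′)
plan-++ {w} {w′} P Q = record
  { chosen = chosen P ++ chosen Q
  ; below  = subst (chosen P ++ chosen Q ⊑*_) (sym (flatten-++ w w′)) (Pointwise.++⁺ (below P) (below Q))
  ; price  = ≤-trans (≤-reflexive (cost-++ (chosen P) (chosen Q))) (+-mono-≤ (price P) (price Q))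
  ; old    = λ h σ q → case ⊑*-split (chosen P) q σ of λ where
      (_ , _ , _ , refl , q₁ , q₂ , v₁ , v₂) → old Q (old P h v₁ q₁) v₂ q₂
  ; new    = λ σ q → case ⊑*-split (chosen P) q σ of λ where
      (_ , _ , _ , refl , q₁ , q₂ , v₁ , v₂) → case new P v₁ q₁ of λ where
        (inj₂ h)    → inj₂ (old Q h v₂ q₂)
        -- The first part followed `w`, hence ended at `home`, so the second part again competes
        -- with a walk from `home`.
        (inj₁ refl) → case new Q (subst (λ x → Walk x _ _) (walk-end-unique v₁ (flatten-walk w)) v₂) q₂ of λ where
          (inj₁ refl) → inj₁ (sym (flatten-++ w w′))
          (inj₂ h)    → inj₂ h
  }

plan-≤ : ∀ {w X Y c c′} → c ≤ c′ → Plan w X Y c → Plan w X Y c′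
plan-≤ le P = record { Plan P ; price = ≤-trans (price P) le }

-- For instance if os begins with a spoke, since only origin and home can be left
-- through a spoke.
Anchored : List Label → Set
Anchored os = ∀ {x y ts} → Walk x ts y → os ⊑* ts → x ≡ origin ⊎ x ≡ home

anchored-++ : ∀ {os os′} → Anchored os → Anchored (os ++ os′)
anchored-++ {os} a σ q with ⊑*-split os q σ
... | _ , _ , _ , _ , q₁ , _ , v₁ , _ = a v₁ q₁

-- A closed walk containing the chosen edges starts at `origin` or `home`. Unless it is the walk of
-- `w`, it ends in `Y`, which contains neither, so it cannot close.
plan-forces : ∀ {w Y c} (P : Plan w ｛ origin ｝ Y c) → Anchored (chosen P) →
  ¬ Y ∋ origin → ¬ Y ∋ home → Forces (flatten w) (chosen P)
plan-forces P a ¬o ¬h x ts σ q with a σ q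
... | inj₁ refl = ⊥-elim (¬o (old P _ σ q))
... | inj₂ refl with new P σ q
...   | inj₁ e = e
...   | inj₂ h = ⊥-elim (¬h h)

-- The automaton for choosing edges

none : Label
none = ⟨ ○ , ○ , ○ ⟩

-- These three choices per letter, each of at most one edge, are enough for the automaton below.
options : Letter → List (List Label)
options A = (none ∷ none ∷ none ∷ [])
          ∷ (⟨ ○ , ● , ○ ⟩ ∷ none ∷ none ∷ [])
          ∷ (none ∷ none ∷ ⟨ ● , ○ , ○ ⟩ ∷ []) ∷ []
options L = (none ∷ none ∷ none ∷ none ∷ [])
          ∷ (⟨ ○ , ○ , ● ⟩ ∷ none ∷ none ∷ none ∷ [])
          ∷ (none ∷ none ∷ none ∷ ⟨ ● , ○ , ○ ⟩ ∷ []) ∷ []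

options-below : ∀ l → All (_⊑* labels l) (options l)
options-below A = (_ ∷ _ ∷ _ ∷ []) ∷ (_ ∷ _ ∷ _ ∷ []) ∷ (_ ∷ _ ∷ _ ∷ []) ∷ []
options-below L = (_ ∷ _ ∷ _ ∷ _ ∷ []) ∷ (_ ∷ _ ∷ _ ∷ _ ∷ []) ∷ (_ ∷ _ ∷ _ ∷ _ ∷ []) ∷ []

data Node : Set where
  n₀ n₁ n₂ n₃ n₄ n₅ n₆ n₇ : Node

-- The confining sets which the strategy keeps available after reading a prefix,
-- each with its price above the base price of the prefix.  The automaton was found
-- by a computer search.
profile : Node → List (ℕ × States)
profile n₀ = (0 , states ● ○ ○ ● ○ ○ ● ○) ∷ []
profile n₁ = (0 , states ● ● ○ ● ○ ● ● ○) ∷ (1 , states ○ ○ ○ ● ○ ○ ● ○) ∷ []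
profile n₂ = (0 , states ● ○ ○ ● ● ● ● ●) ∷ (1 , states ● ○ ○ ● ○ ○ ● ○) ∷ (1 , states ○ ○ ○ ● ○ ○ ● ●) ∷ []
profile n₃ = (0 , states ● ● ○ ● ● ● ● ○) ∷ (1 , states ○ ○ ○ ● ○ ○ ● ○) ∷ []
profile n₄ = (0 , states ● ○ ○ ● ○ ○ ● ○) ∷ (1 , states ○ ○ ○ ● ○ ○ ● ●) ∷ []
profile n₅ = (0 , states ● ● ○ ● ● ● ● ●) ∷ (1 , states ● ● ○ ● ● ○ ● ○) ∷ (1 , states ○ ○ ○ ● ○ ○ ● ●) ∷ []
profile n₆ = (0 , states ● ● ○ ● ● ● ● ●) ∷ (1 , states ● ○ ○ ● ○ ○ ● ○) ∷ (1 , states ○ ○ ○ ● ○ ○ ● ●) ∷ []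
profile n₇ = (0 , states ● ○ ○ ● ● ○ ● ●) ∷ (0 , states ● ● ○ ● ● ○ ● ○)
           ∷ (1 , states ● ○ ○ ● ○ ○ ● ○) ∷ (1 , states ○ ○ ○ ● ○ ○ ● ●) ∷ []

goto : Node → Letter → Node
goto n₀ A = n₁
goto n₀ L = n₂
goto n₁ A = n₃
goto n₁ L = n₄
goto n₂ A = n₄
goto n₂ L = n₅
goto n₃ A = n₆
goto n₃ L = n₇
goto n₄ A = n₁
goto n₄ L = n₂
goto n₅ A = n₄
goto n₅ L = n₇
goto n₆ A = n₄
goto n₆ L = n₇
goto n₇ A = n₆
goto n₇ L = n₅

-- The rise of the base price. Up to a bounded error it amounts to at most one edge per seven
-- subscripts, which `slack-step` makes precise.
toll : Node → Letter → ℕ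
toll n₁ L = 1
toll n₂ A = 1
toll n₃ L = 1
toll n₅ _ = 1
toll n₆ _ = 1
toll _  _ = 0

-- The choice is made backwards: every set wanted after the letter must come from some set available
-- before it, so the set wanted at the end of the word determines all earlier choices.
supplied : Node → Letter → ℕ × States → Bool
supplied q l (c′ , Y) =
  any (λ (c , X) → any (λ os → (run home (labels l) os X ⊆ᵇ Y) ∧ (c + cost os ≤ᵇ toll q l + c′)) (options l))
      (profile q)

all-supplied : ∀ q l → T (all (supplied q l) (profile (goto q l)))
all-supplied n₀ A = _
all-supplied n₀ L = _
all-supplied n₁ A = _
all-supplied n₁ L = _
all-supplied n₂ A = _
all-supplied n₂ L = _
all-supplied n₃ A = _
all-supplied n₃ L = _
all-supplied n₄ A = _
all-supplied n₄ L = _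
all-supplied n₅ A = _
all-supplied n₅ L = _
all-supplied n₆ A = _
all-supplied n₆ L = _
all-supplied n₇ A = _
all-supplied n₇ L = _

Plans : Word → ℕ → Node → Set
Plans w b q = ∀ {e} → e ∈ profile q →
  Σ (Plan w ｛ origin ｝ (proj₂ e) (b + proj₁ e)) λ P → Anchored (chosen P)

plans-extend : ∀ {w b q} → Plans w b q → ∀ l → Plans (w ++ [ l ]) (b + toll q l) (goto q l)
plans-extend {w} {b} {q} ps l {c′ , Y} e∈
  with (c , X) , e₁∈ , s ← find (Any.any⁻ _ (profile q) (All.lookup (All.all⁺ _ _ (all-supplied q l)) e∈))
  with os , os∈ , r ← find (Any.any⁻ _ (options l) s)
  with r₁ , r₂ ← to (T-∧ {run home (labels l) os X ⊆ᵇ Y}) r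
  with P , a ← ps e₁∈
  = plan-≤ (begin
      b + c + cost os     ≡⟨ +-assoc b c _ ⟩
      b + (c + cost os)   ≤⟨ +-monoʳ-≤ b (≤ᵇ⇒≤ _ _ r₂) ⟩
      b + (toll q l + c′) ≡⟨ +-assoc b (toll q l) c′ ⟨
      b + toll q l + c′   ∎)
    (plan-++ P (plan-letter l (All.lookup (options-below l) os∈) r₁)) ,
    anchored-++ {chosen P} a
  where open ≤-Reasoning

-- The spoke of the initial A accounts for the base price 1, and it anchors every plan that extends
-- this one.
plans-A : Plans [ A ] 1 n₀
plans-A (here refl) =
  plan-letter A {⟨ ○ , ● , ○ ⟩ ∷ none ∷ none ∷ []} {｛ origin ｝} (_ ∷ _ ∷ _ ∷ []) _ , anchored
  where
  anchored : Anchored (⟨ ○ , ● , ○ ⟩ ∷ none ∷ none ∷ [])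
  anchored {⟪ _ , ○ , _ ⟫} ((one₃ , one₃) ∷ _) _ = inj₁ refl
  anchored {⟪ _ , ● , _ ⟫} ((one₃ , one₃) ∷ _) _ = inj₂ refl
  anchored ((one₁ , one₁) ∷ _) (() ∷ _)
  anchored ((one₁ , one₂) ∷ _) (() ∷ _)
  anchored ((one₂ , one₁) ∷ _) (() ∷ _)
  anchored ((one₂ , one₂) ∷ _) (() ∷ _)

-- Comparison of prices with the claimed maximum

bound : ℕ → ℕ
bound n = ⌈ (n + 3) / 7 ⌉ + δ n

bound-7+ : ∀ n → bound (7 + n) ≡ suc (bound n)
bound-7+ n = cong (_+ δ n) (m/n≡1+[m∸n]/n {7 + n + 3 + 6} {7} (m≤m+n 7 _))

bound-periodic : ∀ q r → bound (q * 7 + r) ≡ q + bound r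
bound-periodic zero    r = refl
bound-periodic (suc q) r = trans (bound-7+ (q * 7 + r)) (cong suc (bound-periodic q r))

Within : ℕ → ℕ → Set
Within c n = 7 * c ≤ 9 + n ⊎ 7 * c ≡ 11 + n

-- The first alternative gives c ≤ ⌊(n + 9) / 7⌋ = ⌈(n + 3) / 7⌉. The second requires n ≡ 3 modulo
-- 7, where `δ` supplies the one edge more. Periodicity leaves only the residues to be checked.
within⇒≤bound : ∀ c n → Within c n → c ≤ bound n
within⇒≤bound c n w = subst (λ n → c ≤ bound n) (sym n≡)
  (subst (c ≤_) (sym (bound-periodic q r)) (≮⇒≥ (impossible r (m%n<n n 7) ∘ excess)))
  where
  q = n / 7
  r = n % 7
  n≡ : n ≡ q * 7 + r
  n≡ = trans (m≡m%n+[m/n]*n n 7) (+-comm r (q * 7))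
  w′ : Within c (q * 7 + r)
  w′ = subst (Within c) n≡ w
  -- Residue 4 is the only one for which the inequality 7 c ≤ 11 + n would admit a `c` above the
  -- bound. There equality fails, as 11 + 4 is not a multiple of 7.
  excess : q + bound r < c → 7 * suc (bound r) ≤ 9 + r ⊎ r ≢ 4 × 7 * suc (bound r) ≤ 11 + r
  excess lt = case w′ of λ where
      (inj₁ h) → inj₁ (cancel 9 (≤-trans scaled h))
      (inj₂ h) → inj₂ ((λ r≡4 → residue (subst (λ r → 7 * c ≡ 11 + (q * 7 + r)) r≡4 h)) ,
                       cancel 11 (≤-trans scaled (≤-reflexive h)))
    where
    scaled : 7 * suc (bound r) + q * 7 ≤ 7 * c
    scaled = begin
      7 * suc (bound r) + q * 7  ≡⟨ regroup (bound r) q ⟩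
      7 * suc (q + bound r)      ≤⟨ *-monoʳ-≤ 7 lt ⟩
      7 * c                      ∎
      where
      open ≤-Reasoning
      regroup : ∀ b q → 7 * suc b + q * 7 ≡ 7 * suc (q + b)
      regroup = solve-∀
    cancel : ∀ m → 7 * suc (bound r) + q * 7 ≤ m + (q * 7 + r) → 7 * suc (bound r) ≤ m + r
    cancel m h = +-cancelʳ-≤ (q * 7) _ _ (≤-trans h (≤-reflexive (regroup m (q * 7) r)))
      where
      regroup : ∀ m q r → m + (q + r) ≡ m + r + q
      regroup = solve-∀
    residue : 7 * c ≢ 11 + (q * 7 + 4)
    residue e = contradiction
      (trans (sym (m*n%n≡0 c 7)) (trans (cong (_% 7) (trans (*-comm c 7) (trans e (regroup (q * 7))))) ([m+kn]%n≡m%n 15 q 7)))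
      λ ()
      where
      regroup : ∀ q → 11 + (q + 4) ≡ 15 + q
      regroup = solve-∀
  impossible : ∀ r → r < 7 → ¬ (7 * suc (bound r) ≤ 9 + r ⊎ r ≢ 4 × 7 * suc (bound r) ≤ 11 + r)
  impossible 0 _ (inj₁ h) = contradiction (≤⇒≤ᵇ h) λ ()
  impossible 0 _ (inj₂ (_ , h)) = contradiction (≤⇒≤ᵇ h) λ ()
  impossible 1 _ (inj₁ h) = contradiction (≤⇒≤ᵇ h) λ ()
  impossible 1 _ (inj₂ (_ , h)) = contradiction (≤⇒≤ᵇ h) λ ()
  impossible 2 _ (inj₁ h) = contradiction (≤⇒≤ᵇ h) λ ()
  impossible 2 _ (inj₂ (_ , h)) = contradiction (≤⇒≤ᵇ h) λ ()
  impossible 3 _ (inj₁ h) = contradiction (≤⇒≤ᵇ h) λ ()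
  impossible 3 _ (inj₂ (_ , h)) = contradiction (≤⇒≤ᵇ h) λ ()
  impossible 4 _ (inj₁ h) = contradiction (≤⇒≤ᵇ h) λ ()
  impossible 4 _ (inj₂ (ne , _)) = ne refl
  impossible 5 _ (inj₁ h) = contradiction (≤⇒≤ᵇ h) λ ()
  impossible 5 _ (inj₂ (_ , h)) = contradiction (≤⇒≤ᵇ h) λ ()
  impossible 6 _ (inj₁ h) = contradiction (≤⇒≤ᵇ h) λ ()
  impossible 6 _ (inj₂ (_ , h)) = contradiction (≤⇒≤ᵇ h) λ ()
  impossible (suc (suc (suc (suc (suc (suc (suc _))))))) (s≤s (s≤s (s≤s (s≤s (s≤s (s≤s (s≤s ()))))))) _

extent : Word → ℕ
extent w = length (flatten w)

extent-++ : ∀ w w′ → extent (w ++ w′) ≡ extent w + extent w′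
extent-++ w w′ = trans (cong length (flatten-++ w w′)) (length-++ (flatten w))

-- The possible values of extent w + 4 - 7 b after a prefix w with base price b.
data Slack : Node → ℕ → Set where
  s₀  : Slack n₀ 0
  s₁  : Slack n₁ 3
  s₁⁺ : ∀ k → Slack n₁ (5 + k)
  s₂  : Slack n₂ 4
  s₂⁺ : ∀ k → Slack n₂ (6 + k)
  s₃  : Slack n₃ 6
  s₃⁺ : ∀ k → Slack n₃ (8 + k)
  s₄  : Slack n₄ 0
  s₄⁺ : ∀ k → Slack n₄ (2 + k)
  s₅⁺ : ∀ k → Slack n₅ (7 + k)
  s₆⁺ : ∀ k → Slack n₆ (6 + k)
  s₇⁺ : ∀ k → Slack n₇ (3 + k)

slack-step : ∀ {q k} → Slack q k → ∀ l → ∃ λ k′ → Slack (goto q l) k′ × toll q l * 7 + k′ ≡ length (labels l) + k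
slack-step s₀      A = _ , s₁ , refl
slack-step s₀      L = _ , s₂ , refl
slack-step s₁      A = _ , s₃ , refl
slack-step s₁      L = _ , s₄ , refl
slack-step (s₁⁺ k) A = _ , s₃⁺ k , refl
slack-step (s₁⁺ k) L = _ , s₄⁺ k , refl
slack-step s₂      A = _ , s₄ , refl
slack-step s₂      L = _ , s₅⁺ 1 , refl
slack-step (s₂⁺ k) A = _ , s₄⁺ k , refl
slack-step (s₂⁺ k) L = _ , s₅⁺ (3 + k) , refl
slack-step s₃      A = _ , s₆⁺ 3 , refl
slack-step s₃      L = _ , s₇⁺ 0 , refl
slack-step (s₃⁺ k) A = _ , s₆⁺ (5 + k) , refl
slack-step (s₃⁺ k) L = _ , s₇⁺ (2 + k) , refl
slack-step s₄      A = _ , s₁ , refl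
slack-step s₄      L = _ , s₂ , refl
slack-step (s₄⁺ k) A = _ , s₁⁺ k , refl
slack-step (s₄⁺ k) L = _ , s₂⁺ k , refl
slack-step (s₅⁺ k) A = _ , s₄⁺ (1 + k) , refl
slack-step (s₅⁺ k) L = _ , s₇⁺ (1 + k) , refl
slack-step (s₆⁺ k) A = _ , s₄⁺ k , refl
slack-step (s₆⁺ k) L = _ , s₇⁺ k , refl
slack-step (s₇⁺ k) A = _ , s₆⁺ k , refl
slack-step (s₇⁺ k) L = _ , s₅⁺ k , refl

Closing : ℕ × States → Set
Closing (c , X) = c ≡ 1 × ¬ X ∋ origin × ¬ X ∋ home

-- The only set of `n₀` contains `origin`, so no plan can close there. But no letter leads back to
-- `n₀`, so this matters only for the word consisting of a single A.
profile-closes : ∀ q → q ≢ n₀ → ∃ λ e → e ∈ profile q × Closing e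
profile-closes n₀ ne = contradiction refl ne
profile-closes n₁ _ = _ , there (here refl) , refl , (λ ()) , (λ ())
profile-closes n₂ _ = _ , there (there (here refl)) , refl , (λ ()) , (λ ())
profile-closes n₃ _ = _ , there (here refl) , refl , (λ ()) , (λ ())
profile-closes n₄ _ = _ , there (here refl) , refl , (λ ()) , (λ ())
profile-closes n₅ _ = _ , there (there (here refl)) , refl , (λ ()) , (λ ())
profile-closes n₆ _ = _ , there (there (here refl)) , refl , (λ ()) , (λ ())
profile-closes n₇ _ = _ , there (there (there (here refl))) , refl , (λ ()) , (λ ())

Certificate : Word → Set
Certificate w = ∃ λ os → os ⊑* flatten w × Forces (flatten w) os × cost os ≤ bound (extent w)

-- Closing costs one edge above the base price, so slack k gives 7 c = n + 11 - k. Since k = 1 never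
-- occurs, only the two cases of `Within` remain.
slack-gap : ∀ {q k} → Slack q k → k ≡ 0 ⊎ 2 ≤ k
slack-gap s₀      = inj₁ refl
slack-gap s₁      = inj₂ (s≤s (s≤s z≤n))
slack-gap (s₁⁺ _) = inj₂ (s≤s (s≤s z≤n))
slack-gap s₂      = inj₂ (s≤s (s≤s z≤n))
slack-gap (s₂⁺ _) = inj₂ (s≤s (s≤s z≤n))
slack-gap s₃      = inj₂ (s≤s (s≤s z≤n))
slack-gap (s₃⁺ _) = inj₂ (s≤s (s≤s z≤n))
slack-gap s₄      = inj₁ refl
slack-gap (s₄⁺ _) = inj₂ (s≤s (s≤s z≤n))
slack-gap (s₅⁺ _) = inj₂ (s≤s (s≤s z≤n))
slack-gap (s₆⁺ _) = inj₂ (s≤s (s≤s z≤n))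
slack-gap (s₇⁺ _) = inj₂ (s≤s (s≤s z≤n))

goto-≢n₀ : ∀ q l → goto q l ≢ n₀
goto-≢n₀ n₀ A ()
goto-≢n₀ n₀ L ()
goto-≢n₀ n₁ A ()
goto-≢n₀ n₁ L ()
goto-≢n₀ n₂ A ()
goto-≢n₀ n₂ L ()
goto-≢n₀ n₃ A ()
goto-≢n₀ n₃ L ()
goto-≢n₀ n₄ A ()
goto-≢n₀ n₄ L ()
goto-≢n₀ n₅ A ()
goto-≢n₀ n₅ L ()
goto-≢n₀ n₆ A ()
goto-≢n₀ n₆ L ()
goto-≢n₀ n₇ A ()
goto-≢n₀ n₇ L ()

slack-within : ∀ {q k} b n → Slack q k → 7 * b + k ≡ 4 + n → Within (b + 1) n
slack-within {k = k} b n s e with slack-gap s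
... | inj₁ refl = inj₂ (trans (regroup b) (cong (7 +_) e))
  where
  regroup : ∀ b → 7 * (b + 1) ≡ 7 + (7 * b + 0)
  regroup = solve-∀
... | inj₂ 2≤k = inj₁ (+-cancelʳ-≤ 2 _ _ (begin
  7 * (b + 1) + 2  ≤⟨ +-monoʳ-≤ (7 * (b + 1)) 2≤k ⟩
  7 * (b + 1) + k  ≡⟨ regroup b k ⟩
  7 + (7 * b + k)  ≡⟨ cong (7 +_) e ⟩
  11 + n           ≡⟨ +-comm 2 (9 + n) ⟩
  9 + n + 2        ∎))
  where
  open ≤-Reasoning
  regroup : ∀ b k → 7 * (b + 1) + k ≡ 7 + (7 * b + k)
  regroup = solve-∀

plans-certificate : ∀ w pre {b q k} → Plans pre b q → Slack q k → 7 * b + k ≡ 4 + extent pre →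
  (w ≡ [] → q ≢ n₀) → Certificate (pre ++ w)
plans-certificate [] pre {b} {q} ps s e q≢ rewrite ++-identityʳ pre
  with (_ , Y) , e∈ , refl , ¬o , ¬h ← profile-closes q (q≢ refl)
  with P , a ← ps e∈
  = chosen P , below P , plan-forces P a ¬o ¬h ,
    ≤-trans (price P) (within⇒≤bound (b + 1) (extent pre) (slack-within b (extent pre) s e))
plans-certificate (l ∷ w) pre {b} {q} {k} ps s e _ with k′ , s′ , e′ ← slack-step s l
  = subst Certificate (++-assoc pre [ l ] w)
      (plans-certificate w (pre ++ [ l ]) (plans-extend ps l) s′ sizes (λ _ → goto-≢n₀ q l))
  where
  open ≡-Reasoning
  regroup₁ : ∀ b t k → 7 * (b + t) + k ≡ 7 * b + (t * 7 + k)
  regroup₁ = solve-∀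
  regroup₂ : ∀ b l k → 7 * b + (l + k) ≡ 7 * b + k + l
  regroup₂ = solve-∀
  sizes : 7 * (b + toll q l) + k′ ≡ 4 + extent (pre ++ [ l ])
  sizes = begin
    7 * (b + toll q l) + k′           ≡⟨ regroup₁ b (toll q l) k′ ⟩
    7 * b + (toll q l * 7 + k′)       ≡⟨ cong (7 * b +_) e′ ⟩
    7 * b + (length (labels l) + k)   ≡⟨ regroup₂ b (length (labels l)) k ⟩
    7 * b + k + length (labels l)     ≡⟨ cong (_+ length (labels l)) e ⟩
    4 + extent pre + length (labels l)    ≡⟨ cong (λ ts → 4 + extent pre + length ts) (++-identityʳ (labels l)) ⟨
    4 + (extent pre + extent [ l ])         ≡⟨ cong (4 +_) (extent-++ pre [ l ]) ⟨
    4 + extent (pre ++ [ l ])             ∎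

certificate-A : ∀ w → w ≢ [] → Certificate (A ∷ w)
certificate-A w w≢[] = plans-certificate w [ A ] plans-A s₀ refl (λ w≡[] → contradiction w≡[] w≢[])

-- Words without the letter A

plan-[] : ∀ {X Y} → T (X ⊆ᵇ Y) → Plan [] X Y 0
plan-[] {X} {Y} s = record
  { chosen = []
  ; below  = []
  ; price  = z≤n
  ; old    = λ { h [] [] → ⊆ᵇ-sound X Y s _ h }
  ; new    = λ { [] [] → inj₁ refl }
  }

-- One edge per two letters suffices: the last u-edge of the first letter leaves a single competing
-- state, and the second letter, left free, turns it into the two states of the beginning. An odd
-- last letter is free too, at the expense of a third state.
plan-Ls : ∀ i → Plan (replicate i L) (states ○ ○ ○ ○ ● ○ ○ ●) (states ○ ● ○ ○ ● ○ ○ ●) ⌊ i /2⌋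
plan-Ls zero          = plan-[] _
plan-Ls (suc zero)    = plan-letter L {none ∷ none ∷ none ∷ none ∷ []} (_ ∷ _ ∷ _ ∷ _ ∷ []) _
plan-Ls (suc (suc i)) =
  plan-++ {[ L ]} {Y = states ○ ○ ○ ○ ○ ○ ○ ●}
    (plan-letter L {none ∷ none ∷ none ∷ ⟨ ● , ○ , ○ ⟩ ∷ []} (_ ∷ _ ∷ _ ∷ _ ∷ []) _)
    (plan-++ {[ L ]} (plan-letter L {none ∷ none ∷ none ∷ none ∷ []} (_ ∷ _ ∷ _ ∷ _ ∷ []) _) (plan-Ls i))

extent-Ls : ∀ k → extent (replicate k L) ≡ k * 4
extent-Ls zero    = refl
extent-Ls (suc k) = cong (4 +_) (extent-Ls k)

-- Three edges in the first L eliminate all competitors, and the second L needs none. From then on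
-- each pair of letters costs 7 on the left of `Within` and adds 8 to its right. At least nine
-- letters are present since 4 divides n and n ≥ 34.
certificate-Ls : ∀ k → Certificate (replicate (9 + k) L)
certificate-Ls k = chosen plan , below plan , plan-forces plan (anchored-++ {full} anchored) (λ ()) (λ ()) ,
  ≤-trans (price plan) (within⇒≤bound _ (extent w)
    (inj₁ (≤-trans (within k) (≤-reflexive (cong (9 +_) (sym (extent-Ls (9 + k))))))))
  where
  w = replicate (9 + k) L
  full : List Label
  full = ⟨ ● , ○ , ● ⟩ ∷ none ∷ none ∷ ⟨ ● , ○ , ○ ⟩ ∷ []
  anchored : Anchored full
  anchored {⟪ _ , ○ , _ ⟫} ((one₂ , one₂) ∷ _) _ = inj₁ refl
  anchored {⟪ _ , ● , _ ⟫} ((one₂ , one₂) ∷ _) _ = inj₂ refl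
  anchored ((one₁ , one₁) ∷ _) (() ∷ _)
  anchored ((one₁ , one₂) ∷ _) (() ∷ _)
  anchored ((one₂ , one₁) ∷ _) (() ∷ _)
  anchored ((one₃ , one₃) ∷ _) (() ∷ _)
  plan : Plan w ｛ origin ｝ (states ○ ● ○ ○ ● ○ ○ ●) (3 + ⌊ 7 + k /2⌋)
  plan = plan-++ {[ L ]} {Y = ∅} (plan-letter L {full} (_ ∷ _ ∷ _ ∷ _ ∷ []) _)
      (plan-++ {[ L ]} (plan-letter L {none ∷ none ∷ none ∷ none ∷ []} (_ ∷ _ ∷ _ ∷ _ ∷ []) _) (plan-Ls (7 + k)))
  within : ∀ k → 7 * (3 + ⌊ 7 + k /2⌋) ≤ 9 + (9 + k) * 4
  within zero          = ≤ᵇ⇒≤ _ _ _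
  within (suc zero)    = ≤ᵇ⇒≤ _ _ _
  within (suc (suc k)) = begin
    7 * (3 + suc ⌊ 7 + k /2⌋)     ≡⟨ *-distribˡ-+ 7 1 (3 + ⌊ 7 + k /2⌋) ⟩
    7 + 7 * (3 + ⌊ 7 + k /2⌋)     ≤⟨ +-mono-≤ (≤ᵇ⇒≤ 7 8 _) (within k) ⟩
    8 + (9 + (9 + k) * 4)         ∎
    where open ≤-Reasoning

-- The lower bound for words

-- For each of finitely many start states, states which can be reached from it
-- by walks containing a given choice of edges, apart from the given walk itself.
Relation : Set
Relation = List (State × States)

-- The number bounds the size of the choice from below.
Element : Set
Element = ℕ × Relation

-- Only a walk from `home` has to differ from the given one; so only that row starts empty and gains
-- the states reached by leaving it.
extend-row : State → Label → Label → State × States → State × States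
extend-row x t o (s , X) = s , (if s == home then deviate x t o X else advance o X)

extend : State → Label → Label → Element → Element
extend x t o (c , R) = weight o + c , map (extend-row x t o) R

allLabels : List Label
allLabels = ⟨ ○ , ○ , ○ ⟩ ∷ ⟨ ○ , ○ , ● ⟩ ∷ ⟨ ○ , ● , ○ ⟩ ∷ ⟨ ○ , ● , ● ⟩
          ∷ ⟨ ● , ○ , ○ ⟩ ∷ ⟨ ● , ○ , ● ⟩ ∷ ⟨ ● , ● , ○ ⟩ ∷ ⟨ ● , ● , ● ⟩ ∷ []

∈-allLabels : ∀ o → o ∈ allLabels
∈-allLabels ⟨ ○ , ○ , ○ ⟩ = here refl
∈-allLabels ⟨ ○ , ○ , ● ⟩ = there (here refl)
∈-allLabels ⟨ ○ , ● , ○ ⟩ = there (there (here refl))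
∈-allLabels ⟨ ○ , ● , ● ⟩ = there (there (there (here refl)))
∈-allLabels ⟨ ● , ○ , ○ ⟩ = there (there (there (there (here refl))))
∈-allLabels ⟨ ● , ○ , ● ⟩ = there (there (there (there (there (here refl)))))
∈-allLabels ⟨ ● , ● , ○ ⟩ = there (there (there (there (there (there (here refl))))))
∈-allLabels ⟨ ● , ● , ● ⟩ = there (there (there (there (there (there (there (here refl)))))))

parts : Label → List Label
parts t = filterᵇ (_⊑ᵇ t) allLabels

∈-parts : ∀ {o t} → o ⊑ t → o ∈ parts t
∈-parts {o} {t} = ∈-filter⁺ (T? ∘ (_⊑ᵇ t)) (∈-allLabels o)

infix 4 _≼_

_≼ʳ_ : Relation → Relation → Bool
[]            ≼ʳ S             = ●
((x , X) ∷ R) ≼ʳ []            = ○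
((x , X) ∷ R) ≼ʳ ((y , Y) ∷ S) = (x == y) ∧ (X ⊆ᵇ Y) ∧ (R ≼ʳ S)

_≼_ : Element → Element → Bool
(c , R) ≼ (d , S) = (c ≤ᵇ d) ∧ (R ≼ʳ S)

-- A smaller element makes a weaker claim about a choice of edges, see `≼-sound`. So the claim that
-- some element of the list is sound loses nothing when the larger one is dropped.
insert : Element → List Element → List Element
insert e es = if any (_≼ e) es then es else e ∷ es

-- An insertion compares only with elements inserted before; the second pass, in the opposite order,
-- removes those dominated by later ones.
prune : List Element → List Element
prune es = foldr insert [] (reverse (foldr insert [] es))

stepAll : State → Label → List Element → List Element
stepAll x t es = prune (concatMap (λ e → map (λ o → extend x t o e) (parts t)) es)

runAll : State → List Label → List Element → List Element
runAll x []       es = es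
runAll x (t ∷ ts) es = runAll (next x t) ts (stepAll x t es)

returns loops : Element → Bool
returns (_ , R) = any (λ (x , X) → (x == home) ∧ at X home) R
loops   (_ , R) = any (λ (x , X) → at X x) R

-- A competing walk that is back at `home` can follow the given walk to its end, so such a choice
-- never forces and need not be pursued.
letterAll : Letter → List Element → List Element
letterAll l es = filterᵇ (not ∘ returns) (runAll home (labels l) es)

wordAll : Word → List Element → List Element
wordAll []      es = es
wordAll (l ∷ w) es = wordAll w (letterAll l es)

-- Leaving out start states could only weaken the lower bound; these five suffice for all the
-- checks.
sources : List State
sources = ⟪ ○ , ○ , ○ ⟫ ∷ ⟪ ○ , ○ , ● ⟫ ∷ ⟪ ○ , ● , ○ ⟫ ∷ ⟪ ○ , ● , ● ⟫ ∷ ⟪ ● , ● , ● ⟫ ∷ []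

start-row : State → State × States
start-row x = x , (if x == home then ∅ else ｛ x ｝)

start : List Element
start = (0 , map start-row sources) ∷ []

LA : Word
LA = L ∷ A ∷ []

bump : Element → Element
bump (c , R) = suc c , R

persistent : List Element → Bool
persistent es = all (λ e → any (λ e′ → bump e′ ≼ e) es) (wordAll LA es)

-- An element which loops belongs to a choice that does not force, so only the others have to be
-- costly.
expensive : ℕ → List Element → Bool
expensive c es = all (λ e → loops e ∨ (c ≤ᵇ proj₁ e)) es

check : Word → Bool
check w = (λ es → persistent es ∧ expensive (bound (extent w)) es) (wordAll w start)

-- One word for each residue modulo 7 of its length, found by a computer search.
tail : ℕ → Word
tail 0 = L ∷ A ∷ []
tail 1 = L ∷ L ∷ L ∷ A ∷ []
tail 2 = A ∷ A ∷ A ∷ []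
tail 3 = A ∷ L ∷ A ∷ []
tail 4 = L ∷ L ∷ A ∷ []
tail 5 = A ∷ L ∷ A ∷ A ∷ L ∷ A ∷ A ∷ L ∷ A ∷ A ∷ L ∷ A ∷ []
tail _ = A ∷ A ∷ []

Walks : List Label → List Label → State → State → Set
Walks ts os x y = ∃ λ us → Walk x us y × os ⊑* us × (x ≡ home → us ≢ ts)

Sound : ℕ → List Label → List Label → Element → Set
Sound k ts os (c , R) = k + c ≤ cost os × All (λ (x , X) → ∀ y → X ∋ y → Walks ts os x y) R

-- The number `k` counts edges already paid for and no longer recorded in the elements, one for each
-- repetition of `LA`. The first alternative is that of a competitor which has rejoined the given
-- walk.
Covers : ℕ → State → List Label → List Element → Set
Covers k x ts es = ∀ {os} → os ⊑* ts → Walks ts os home x ⊎ Any (Sound k ts os) es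

walks-∷ʳ : ∀ {ts os t o x y z} → Walks ts os x y → Step o y z → Walks (ts ∷ʳ t) (os ∷ʳ o) x z
walks-∷ʳ {ts} (us , σ , p , ne) (l , i , s , refl) =
  us ∷ʳ l , walk-++ σ (i ∷ []) , Pointwise.++⁺ p (s ∷ []) , λ e → ne e ∘ ∷ʳ-injectiveˡ us ts

⊑*-∷ʳ : ∀ ts {t os} → os ⊑* ts ∷ʳ t → ∃₂ λ os′ o → os ≡ os′ ∷ʳ o × os′ ⊑* ts × o ⊑ t
⊑*-∷ʳ []       (s ∷ []) = [] , _ , refl , [] , s
⊑*-∷ʳ (_ ∷ ts) (s ∷ p) with os′ , o , refl , p′ , s′ ← ⊑*-∷ʳ ts p = _ ∷ os′ , o , refl , s ∷ p′ , s′

extend-sound : ∀ {k x ts os t o} e → Walk home ts x → os ⊑* ts →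
  Sound k ts os e → Sound k (ts ∷ʳ t) (os ∷ʳ o) (extend x t o e)
extend-sound {k} {x} {ts} {os} {t} {o} (c , R) σ p (le , rows) = costs , All.map⁺ (All.map (λ {e} → row e) rows)
  where
  open ≤-Reasoning
  regroup : ∀ k w c → k + (w + c) ≡ k + c + (w + 0)
  regroup = solve-∀
  costs : k + (weight o + c) ≤ cost (os ∷ʳ o)
  costs = begin
    k + (weight o + c)      ≡⟨ regroup k (weight o) c ⟩
    k + c + (weight o + 0)  ≤⟨ +-monoˡ-≤ _ le ⟩
    cost os + cost [ o ]    ≡⟨ cost-++ os [ o ] ⟨
    cost (os ∷ʳ o)          ∎
  kept : ∀ {s} X y → (∀ y → X ∋ y → Walks ts os s y) → advance o X ∋ y → Walks (ts ∷ʳ t) (os ∷ʳ o) s y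
  kept X y ws h with x′ , h′ , st ← advance⁻ X {o} y h = walks-∷ʳ (ws x′ h′) st
  row : ∀ e → (∀ y → proj₂ e ∋ y → Walks ts os (proj₁ e) y) →
    ∀ y → proj₂ (extend-row x t o e) ∋ y → Walks (ts ∷ʳ t) (os ∷ʳ o) (proj₁ e) y
  row (s , X) ws y h with s == home in eq
  ... | false = kept X y ws h
  ... | true with deviate⁻ x t o X y h
  ...   | inj₁ h′ = kept X y ws h′
  ...   | inj₂ ((l , i , q , refl) , ne) with refl ← ==-sound s home (from T-≡ eq) =
    ts ∷ʳ l , walk-++ σ (i ∷ []) , Pointwise.++⁺ p (q ∷ []) ,
    λ _ e → ne (cong (next x) (∷ʳ-injectiveʳ ts ts e))

≼ʳ-sound : ∀ {P : State → State → Set} R S → T (R ≼ʳ S) →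
  All (λ (x , X) → ∀ y → X ∋ y → P x y) S → All (λ (x , X) → ∀ y → X ∋ y → P x y) R
≼ʳ-sound []            S             _ _        = []
≼ʳ-sound ((x , X) ∷ R) ((y , Y) ∷ S) h (p ∷ ps)
  with e , h  ← to (T-∧ {x == y}) h
  with s , h  ← to (T-∧ {X ⊆ᵇ Y}) h
  with refl ← ==-sound x y e = (λ z → p z ∘ ⊆ᵇ-sound X Y s z) ∷ ≼ʳ-sound R S h ps

≼-sound : ∀ {k ts os} e e′ → T (e ≼ e′) → Sound k ts os e′ → Sound k ts os e
≼-sound {k} (c , R) (d , S) h (le , rows) with h₁ , h₂ ← to (T-∧ {c ≤ᵇ d}) h =
  ≤-trans (+-monoʳ-≤ k (≤ᵇ⇒≤ c d h₁)) le , ≼ʳ-sound R S h₂ rows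

insert-sound : ∀ {k ts os} e es → Any (Sound k ts os) (e ∷ es) → Any (Sound k ts os) (insert e es)
insert-sound e es a with any (_≼ e) es in eq
... | false = a
insert-sound e es (there a) | true = a
insert-sound e es (here s) | true with e′ , e′∈ , h ← find (Any.any⁻ (_≼ e) es (from T-≡ eq)) =
  lose e′∈ (≼-sound e′ e h s)

inserts-sound : ∀ {k ts os} es → Any (Sound k ts os) es → Any (Sound k ts os) (foldr insert [] es)
inserts-sound (e ∷ es) (here s)  = insert-sound e (foldr insert [] es) (here s)
inserts-sound (e ∷ es) (there a) = insert-sound e (foldr insert [] es) (there (inserts-sound es a))

prune-sound : ∀ {k ts os} es → Any (Sound k ts os) es → Any (Sound k ts os) (prune es)
prune-sound es a = inserts-sound _ (Any.reverse⁺ (inserts-sound es a))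

stepAll-covers : ∀ {k x ts t es} → Walk home ts x → Legal x t →
  Covers k x ts es → Covers k (next x t) (ts ∷ʳ t) (stepAll x t es)
stepAll-covers {k} {x} {ts} {t} {es} σ i cov q with os , o , refl , p , s ← ⊑*-∷ʳ ts q | cov p
... | inj₁ ws = inj₁ (walks-∷ʳ ws (t , i , s , refl))
... | inj₂ a = inj₂ (prune-sound _ (Any.concatMap⁺ _ (Any.map
  (λ {e} snd → Any.map⁺ (lose (∈-parts s) (extend-sound e σ p snd))) a)))

runAll-covers : ∀ {k x y ts us es} → Walk home ts x → Walk x us y →
  Covers k x ts es → Covers k y (ts ++ us) (runAll x us es)
runAll-covers {ts = ts} σ [] cov rewrite ++-identityʳ ts = cov
runAll-covers {ts = ts} σ (_∷_ {t = t} {ts = us} i w) cov rewrite sym (++-assoc ts [ t ] us) =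
  runAll-covers (walk-++ σ (i ∷ [])) w (stepAll-covers σ i cov)

T-not-not : ∀ {b} → ¬ T (not b) → T b
T-not-not {●} _ = _
T-not-not {○} f = f _

letterAll-covers : ∀ {k ts es} l → Walk home ts home →
  Covers k home ts es → Covers k home (ts ++ labels l) (letterAll l es)
letterAll-covers {k} {ts} {es} l σ cov p with runAll-covers σ (labels-walk l) cov p
... | inj₁ ws = inj₁ ws
... | inj₂ a with e@(c , R) , e∈ , snd@(_ , rows) ← find a | T? (not (returns e))
...   | yes nr = inj₂ (lose (∈-filter⁺ (T? ∘ not ∘ returns) e∈ nr) snd)
...   | no r with (x , X) , x∈ , h ← find (Any.any⁻ _ R (T-not-not r))
      with e , h ← to (T-∧ {x == home}) h
      with refl ← ==-sound x home e = inj₁ (All.lookup rows x∈ home h)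

wordAll-covers : ∀ {k ts es} w → Walk home ts home →
  Covers k home ts es → Covers k home (ts ++ flatten w) (wordAll w es)
wordAll-covers {ts = ts} [] σ cov rewrite ++-identityʳ ts = cov
wordAll-covers {ts = ts} (l ∷ w) σ cov rewrite sym (++-assoc ts (labels l) (flatten w)) =
  wordAll-covers w (walk-++ σ (labels-walk l)) (letterAll-covers l σ cov)

start-covers : Covers 0 home [] start
start-covers [] = inj₂ (here (z≤n , All.map⁺ {f = start-row} (All.universal (λ x → row x (x == home) refl) sources)))
  where
  row : ∀ x b → (x == home) ≡ b → ∀ y → (if b then ∅ else ｛ x ｝) ∋ y → Walks [] [] x y
  row x true  _  y h = ⊥-elim (subst T (at-comprehend (λ _ → ○) y) h)
  row x false eq y h with refl ← ｛｝⁻ x {y} h = [] , [] , [] , λ { refl → contradiction eq λ () }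

-- Each element obtained after `LA` lies above an old one whose number is raised by one, so the old
-- list can be restored and the extra edge credited to `k`.
persistent-covers : ∀ {k ts} es → T (persistent es) →
  Covers k home ts (wordAll LA es) → Covers (suc k) home ts es
persistent-covers {k} es d cov p with cov p
... | inj₁ ws = inj₁ ws
... | inj₂ a with e , e∈ , snd ← find a
  with e′@(c , R) , e′∈ , h ← find (Any.any⁻ _ es (All.lookup (All.all⁺ _ _ d) e∈))
  with le , rows ← ≼-sound (bump e′) e h snd =
  inj₂ (lose e′∈ (≤-trans (≤-reflexive (sym (+-suc k c))) le , rows))

family : Word → ℕ → Word
family w zero    = w
family w (suc q) = family w q ++ LA

family-covers : ∀ w q → T (check w) → Covers q home (flatten (family w q)) (wordAll w start)
family-covers w zero    h = wordAll-covers w [] start-covers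
family-covers w (suc q) h rewrite flatten-++ (family w q) LA =
  persistent-covers es (proj₁ (to (T-∧ {persistent es}) h))
    (wordAll-covers LA (flatten-walk (family w q)) (family-covers w q h))
  where es = wordAll w start

extent-family : ∀ w q → extent (family w q) ≡ q * 7 + extent w
extent-family w zero    = refl
extent-family w (suc q) = trans (extent-++ (family w q) LA) (trans (+-comm _ 7) (cong (7 +_) (extent-family w q)))

-- A state is determined by the last two labels.
walk-start-forgotten : ∀ {x x′ y y′ t t′ ts} → Walk x (t ∷ t′ ∷ ts) y → Walk x′ (t ∷ t′ ∷ ts) y′ → y ≡ y′
walk-start-forgotten (_ ∷ _ ∷ σ) (_ ∷ _ ∷ w) = walk-end-unique σ w

-- For a start other than `home`, `Walks` does not claim that the labels differ from the given ones.
-- A closed walk with the given labels, however, must start at `home`, where the difference is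
-- claimed.
closed-home : ∀ ts {x} → 2 ≤ length ts → Walk x ts x → Walk home ts home → x ≡ home
closed-home (_ ∷ _ ∷ _) _        σ w = walk-start-forgotten σ w
closed-home (_ ∷ [])    (s≤s ()) σ w

-- A choice that forces admits neither a competitor returning to `home` nor a looping element. What
-- is left costs at least `bound (extent w)`, with one edge more for each `LA`.
family-lower : ∀ w q {os} → T (check w) → 2 ≤ extent (family w q) →
  os ⊑* flatten (family w q) → Forces (flatten (family w q)) os → bound (extent (family w q)) ≤ cost os
family-lower w q {os} h le p forces with family-covers w q h p
... | inj₁ (us , σ , r , ne) = ⊥-elim (ne refl (forces home us σ r))
... | inj₂ a with e@(c , R) , e∈ , small , rows ← find a
  with to (T-∨ {loops e}) (All.lookup (All.all⁺ _ _ (proj₂ (to (T-∧ {persistent (wordAll w start)}) h))) e∈)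
... | inj₂ b = begin
  bound (extent (family w q))  ≡⟨ cong bound (extent-family w q) ⟩
  bound (q * 7 + extent w)     ≡⟨ bound-periodic q (extent w) ⟩
  q + bound (extent w)         ≤⟨ +-monoʳ-≤ q (≤ᵇ⇒≤ _ c b) ⟩
  q + c                      ≤⟨ small ⟩
  cost os                    ∎
  where open ≤-Reasoning
... | inj₁ lp with (x , X) , x∈ , h′ ← find (Any.any⁻ _ R lp)
  with us , σ , r , ne ← All.lookup rows x∈ x h′
  with refl ← forces x us σ r = ⊥-elim (ne (closed-home _ le σ (flatten-walk (family w q))) refl)

-- Matchings as walks

+-left-comm : ∀ a b c → a + (b + c) ≡ b + (a + c)
+-left-comm = solve-∀

-- This is the state in which the label with index `2 + k` is read; the shift by two avoids
-- subtraction.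
st : (ℕ → Label) → ℕ → State
st x k = ⟪ hop (x k) , hop (x (1 + k)) , rim (x (1 + k)) ⟫

Matching : (ℕ → Label) → Set
Matching x = ∀ k → Legal (st x k) (x (2 + k))

seg : (ℕ → Label) → ℕ → ℕ → List Label
seg x r zero    = []
seg x r (suc m) = x r ∷ seg x (suc r) m

length-seg : ∀ x r m → length (seg x r m) ≡ m
length-seg x r zero    = refl
length-seg x r (suc m) = cong suc (length-seg x (suc r) m)

seg-cong : ∀ {x y} r s m → (∀ j → j < m → x (j + r) ≡ y (j + s)) → seg x r m ≡ seg y s m
seg-cong r s zero    eq = refl
seg-cong {x} {y} r s (suc m) eq = cong₂ _∷_ (eq 0 z<s) (seg-cong (suc r) (suc s) m λ j j<m →
  trans (cong x (+-suc j r)) (trans (eq (suc j) (s<s j<m)) (cong y (sym (+-suc j s)))))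

seg-+ : ∀ x r m m′ → seg x r (m + m′) ≡ seg x r m ++ seg x (m + r) m′
seg-+ x r zero    m′ = refl
seg-+ x r (suc m) m′ = cong (x r ∷_) (trans (seg-+ x (suc r) m m′) (cong (λ s → seg x (suc r) m ++ seg x s m′) (+-suc m r)))

seg-⊑* : ∀ {x y} r m → (∀ j → x j ⊑ y j) → seg x r m ⊑* seg y r m
seg-⊑* r zero    p = []
seg-⊑* r (suc m) p = p r ∷ seg-⊑* (suc r) m p

seg-⊑*⁻ : ∀ {x y} r m → seg x r m ⊑* seg y r m → ∀ j → j < m → x (j + r) ⊑ y (j + r)
seg-⊑*⁻ r (suc m) (p ∷ ps) zero    _         = p
seg-⊑*⁻ {x} {y} r (suc m) (p ∷ ps) (suc j) (s<s j<m) =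
  subst (λ i → x i ⊑ y i) (+-suc j r) (seg-⊑*⁻ (suc r) m ps j j<m)

matching-walk : ∀ {x} → Matching x → ∀ k m → Walk (st x k) (seg x (2 + k) m) (st x (m + k))
matching-walk mt k zero    = []
matching-walk {x} mt k (suc m) = mt k ∷ subst (Walk _ _) (cong (st x) (+-suc m k)) (matching-walk mt (suc k) m)

-- From the third label on, the states of a walk depend only on its labels, whatever its start.
walk-legal : ∀ {x y z} r m → Walk y (seg x r m) z → ∀ j → 2 + j < m → Legal (st x (j + r)) (x (2 + (j + r)))
walk-legal r (suc (suc (suc m))) (_ ∷ _ ∷ l ∷ _) zero    _ = l
walk-legal r (suc (suc zero))    _               zero    (s<s (s<s ()))
walk-legal {x} r (suc m) (_ ∷ w) (suc j) (s<s lt) =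
  subst (λ i → Legal (st x i) (x (2 + i))) (+-suc j r) (walk-legal (suc r) m w j lt)

nth : List Label → ℕ → Label
nth []       _       = ⟨ ○ , ○ , ○ ⟩
nth (t ∷ ts) zero    = t
nth (t ∷ ts) (suc j) = nth ts j

seg-nth : ∀ ts → seg (nth ts) 0 (length ts) ≡ ts
seg-nth []       = refl
seg-nth (t ∷ ts) = cong (t ∷_) (trans
  (seg-cong 1 0 (length ts) λ j _ → trans (cong (nth (t ∷ ts)) (+-comm j 1)) (cong (nth ts) (sym (+-identityʳ j))))
  (seg-nth ts))

Periodic : ℕ → (ℕ → Label) → Set
Periodic n x = ∀ k → x (n + k) ≡ x k

module _ {n} {x : ℕ → Label} (per : Periodic n x) where

  periodic-* : ∀ c k → x (c * n + k) ≡ x k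
  periodic-* zero    k = refl
  periodic-* (suc c) k = trans (cong x (+-assoc n (c * n) k)) (trans (per (c * n + k)) (periodic-* c k))

  st-periodic-* : ∀ c k → st x (c * n + k) ≡ st x k
  st-periodic-* c k rewrite periodic-* c k
    | sym (+-suc (c * n) k) | periodic-* c (suc k) = refl

  closed-repeat : ∀ {y} r → Walk y (seg x r n) y → ∀ c → Walk y (seg x r (c * n)) y
  closed-repeat r w zero    = []
  closed-repeat r w (suc c) rewrite seg-+ x r n (c * n)
    | seg-cong {x} {x} (n + r) r (c * n) (λ j _ → trans (cong x (+-left-comm j n r)) (per (j + r))) =
      walk-++ w (closed-repeat r w c)

  -- Going round often enough puts every index beyond the first two labels, where `walk-legal`
  -- applies.
  closed-matching : ∀ {y} → 1 ≤ n → Walk y (seg x 0 n) y → Matching x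
  closed-matching 1≤n w k = subst (λ i → Legal (st x i) (x (2 + i))) (+-identityʳ k)
    -- As 1 ≤ n, `3 + k` rounds contain more than `2 + k` labels.
    (walk-legal 0 ((3 + k) * n) (closed-repeat 0 w (3 + k)) k
      (≤-trans (≤-reflexive (sym (*-identityʳ (3 + k)))) (*-monoʳ-≤ (3 + k) 1≤n)))

  cost-rotate : ∀ r → cost (seg x r n) ≡ cost (seg x 0 n)
  cost-rotate zero    = refl
  cost-rotate (suc r) = trans (+-cancelˡ-≡ (weight (x r)) _ _ (begin
    weight (x r) + cost (seg x (suc r) n)      ≡⟨⟩
    cost (seg x r (suc n))                     ≡⟨ cong (λ m → cost (seg x r m)) (+-comm 1 n) ⟩
    cost (seg x r (n + 1))                     ≡⟨ cong cost (seg-+ x r n 1) ⟩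
    cost (seg x r n ++ x (n + r) ∷ [])         ≡⟨ cost-++ (seg x r n) _ ⟩
    cost (seg x r n) + (weight (x (n + r)) + 0) ≡⟨ cong (λ t → cost (seg x r n) + (weight t + 0)) (per r) ⟩
    cost (seg x r n) + (weight (x r) + 0)      ≡⟨ regroup (cost (seg x r n)) _ ⟩
    weight (x r) + cost (seg x r n)            ∎)) (cost-rotate r)
    where
    open ≡-Reasoning
    regroup : ∀ a b → a + (b + 0) ≡ b + a
    regroup = solve-∀

-- The size of an edge set as a cost

count : ∀ {m} → (Fin m → Bool) → ℕ
count {zero}  f = 0
count {suc m} f = bit (f fzero) + count (f ∘ fsuc)

∣∣-count : ∀ {m} (S : Subset m) → ∣ S ∣ ≡ count (lookup S)
∣∣-count []          = refl
∣∣-count (true  ∷ S) = cong suc (∣∣-count S)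
∣∣-count (false ∷ S) = ∣∣-count S

count-↑ : ∀ m {k} (f : Fin (m + k) → Bool) → count f ≡ count (f ∘ (_↑ˡ k)) + count (f ∘ (m ↑ʳ_))
count-↑ zero    f = refl
count-↑ (suc m) f = trans (cong (bit (f fzero) +_) (count-↑ m (f ∘ fsuc))) (sym (+-assoc (bit (f fzero)) _ _))

count-edges : ∀ n (f : Fin (3 * n) → Bool) →
  count f ≡ count (f ∘ uu {n}) + (count (f ∘ spoke {n}) + (count (f ∘ vv {n}) + 0))
count-edges n f = trans (count-↑ n f) (cong (count (f ∘ uu {n}) +_)
  (trans (count-↑ n _) (cong (count (f ∘ spoke {n}) +_) (count-↑ n _))))

count-cost : ∀ m {f g h : Fin m → Bool} x k → (∀ i → x (toℕ i + k) ≡ ⟨ f i , g i , h i ⟩) →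
  count f + (count g + (count h + 0)) ≡ cost (seg x k m)
count-cost zero    x k eq = refl
count-cost (suc m) {f} {g} {h} x k eq = trans
  (regroup (bit (f fzero)) (bit (g fzero)) (bit (h fzero)) (count (f ∘ fsuc)) (count (g ∘ fsuc)) (count (h ∘ fsuc)))
  (cong₂ _+_ (cong weight (sym (eq fzero)))
    (count-cost m x (suc k) λ i → trans (cong x (+-suc (toℕ i) k)) (eq (fsuc i))))
  where
  regroup : ∀ a b c p q r → a + p + (b + q + (c + r + 0)) ≡ a + (b + c) + (p + (q + (r + 0)))
  regroup = solve-∀

-- Subscripts modulo n and periodic labels

module _ {n : ℕ} .{{_ : NonZero n}} where

  pos : ℕ → Fin n
  pos k = k mod n

  toℕ-pos : ∀ k → toℕ (pos k) ≡ k % n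
  toℕ-pos k = toℕ-fromℕ< (m%n<n k n)

  pos-≡ : ∀ {j k} → j % n ≡ k % n → pos j ≡ pos k
  pos-≡ {j} {k} e = toℕ-injective (trans (toℕ-pos j) (trans e (sym (toℕ-pos k))))

  pos-toℕ : ∀ i → pos (toℕ i) ≡ i
  pos-toℕ i = toℕ-injective (trans (toℕ-pos (toℕ i)) (m<n⇒m%n≡m (toℕ<n i)))

  pos-* : ∀ c k → pos (c * n + k) ≡ pos k
  pos-* c k = pos-≡ (trans (cong (_% n) (+-comm (c * n) k)) ([m+kn]%n≡m%n k c n))

  pos-⊕ : ∀ k j → pos k ⊕ j ≡ pos (j + k)
  pos-⊕ k j = toℕ-injective (begin
    toℕ (pos k ⊕ j)            ≡⟨ toℕ-fromℕ< _ ⟩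
    (toℕ (pos k) + j) % n      ≡⟨ cong (λ i → (i + j) % n) (toℕ-pos k) ⟩
    (k % n + j) % n            ≡⟨ %-distribˡ-+ (k % n) j n ⟩
    (k % n % n + j % n) % n    ≡⟨ cong (λ i → (i + j % n) % n) (m%n%n≡m%n k n) ⟩
    (k % n + j % n) % n        ≡⟨ %-distribˡ-+ k j n ⟨
    (k + j) % n                ≡⟨ cong (_% n) (+-comm k j) ⟩
    (j + k) % n                ≡⟨ toℕ-pos (j + k) ⟨
    toℕ (pos (j + k))          ∎)
    where open ≡-Reasoning

  -- Adding c * pred n undoes adding c.
  pos-back : ∀ c k → pos (c * pred n + (c + k)) ≡ pos k
  pos-back c k = trans (cong pos (begin
    c * pred n + (c + k)  ≡⟨ regroup c (pred n) k ⟩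
    c * suc (pred n) + k  ≡⟨ cong (λ m → c * m + k) (suc-pred n) ⟩
    c * n + k             ∎)) (pos-* c k)
    where
    open ≡-Reasoning
    regroup : ∀ c p k → c * p + (c + k) ≡ c * suc p + k
    regroup = solve-∀

  pos-cancel : ∀ c {j k} → pos (c + j) ≡ pos (c + k) → pos j ≡ pos k
  pos-cancel c {j} {k} e = begin
    pos j                         ≡⟨ pos-back c j ⟨
    pos (c * pred n + (c + j))    ≡⟨ pos-⊕ (c + j) (c * pred n) ⟨
    pos (c + j) ⊕ c * pred n      ≡⟨ cong (_⊕ c * pred n) e ⟩
    pos (c + k) ⊕ c * pred n      ≡⟨ pos-⊕ (c + k) (c * pred n) ⟩
    pos (c * pred n + (c + k))    ≡⟨ pos-back c k ⟩
    pos k                         ∎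
    where open ≡-Reasoning

  pos-surjective : ∀ c i → ∃ λ k → pos (c + k) ≡ i
  pos-surjective c i = c * pred n + toℕ i , (begin
    pos (c + (c * pred n + toℕ i))   ≡⟨ cong pos (+-left-comm c (c * pred n) (toℕ i)) ⟩
    pos (c * pred n + (c + toℕ i))   ≡⟨ pos-back c (toℕ i) ⟩
    pos (toℕ i)                      ≡⟨ pos-toℕ i ⟩
    i                                ∎)
    where
    open ≡-Reasoning

  lab : EdgeSet (P n) → ℕ → Label
  lab M k = ⟨ lookup M (uu (pos k)) , lookup M (spoke (pos k)) , lookup M (vv (pos k)) ⟩

  lab-pos : ∀ M {j k} → pos j ≡ pos k → lab M j ≡ lab M k
  lab-pos M = cong (λ i → ⟨ lookup M (uu i) , lookup M (spoke i) , lookup M (vv i) ⟩)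

  lab-periodic : ∀ M → Periodic n (lab M)
  lab-periodic M k = lab-pos M (trans (cong (λ m → pos (m + k)) (sym (+-identityʳ n))) (pos-* 1 k))

  ∣∣-cost : ∀ S r → ∣ S ∣ ≡ cost (seg (lab S) r n)
  ∣∣-cost S r = trans (∣∣-count S) (trans (count-edges n (lookup S))
    (trans (count-cost n {lookup S ∘ uu} {lookup S ∘ spoke} {lookup S ∘ vv} (lab S) 0 λ i →
      cong (λ j → ⟨ lookup S (uu j) , lookup S (spoke j) , lookup S (vv j) ⟩)
           (trans (cong pos (+-identityʳ (toℕ i))) (pos-toℕ i)))
    (sym (cost-rotate (lab-periodic S) r))))

  data EdgeView : Fin (3 * n) → Set where
    is-uu    : ∀ i → EdgeView (uu {n} i)
    is-spoke : ∀ i → EdgeView (spoke {n} i)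
    is-vv    : ∀ i → EdgeView (vv {n} i)

  edgeView : ∀ e → EdgeView e
  edgeView e = subst EdgeView (combine-remQuot {3} n e) (view (remQuot {3} n e))
    where
    view : ∀ p → EdgeView (combine (proj₁ p) (proj₂ p))
    view (0F , i) = is-uu i
    view (1F , i) = is-spoke i
    view (2F , i) = is-vv i

  ⊆⇒lab-⊑ : ∀ {S M} → S ⊆ M → ∀ k → lab S k ⊑ lab M k
  ⊆⇒lab-⊑ {S} {M} s k = and (le (uu (pos k))) (le (spoke (pos k))) (le (vv (pos k)))
    where
    le : ∀ e → T (lookup S e ⇒ᵇ lookup M e)
    le e with lookup S e in eq
    ... | false = _
    ... | true rewrite []=⇒lookup (s (lookup⇒[]= e S eq)) = _
    and : ∀ {a b c} → T a → T b → T c → T (a ∧ b ∧ c)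
    and {true} {true} {true} _ _ _ = _

-- Perfect matchings as conditions on the three edges at each vertex

record Incident {N} (Q : Fin N → Set) (e₁ e₂ e₃ : Fin N) : Set where
  field
    inc₁    : Q e₁
    inc₂    : Q e₂
    inc₃    : Q e₃
    only    : ∀ {e} → Q e → e ≡ e₁ ⊎ e ≡ e₂ ⊎ e ≡ e₃
    apart₁₂ : e₁ ≢ e₂
    apart₁₃ : e₁ ≢ e₃
    apart₂₃ : e₂ ≢ e₃

module _ {N} {M : Subset N} {Q : Fin N → Set} {e₁ e₂ e₃} (I : Incident Q e₁ e₂ e₃) where
  open Incident I

  private
    excluded : ∀ {e e′} → (∀ {y} → y ∈ˢ M × Q y → e ≡ y) → Q e′ → e ≢ e′ → lookup M e′ ≡ false
    excluded {e′ = e′} unique q ne with lookup M e′ in eq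
    ... | false = refl
    ... | true  = ⊥-elim (ne (unique (lookup⇒[]= e′ M eq , q)))

    one : ∀ {a b c a′ b′ c′} → a ≡ a′ → b ≡ b′ → c ≡ c′ → One a′ b′ c′ → One a b c
    one refl refl refl o = o

    conflict : ∀ {e} {A : Set} → e ∈ˢ M → lookup M e ≡ false → A
    conflict e∈ eq = ⊥-elim (case trans (sym ([]=⇒lookup e∈)) eq of λ ())

  unique⇒One : ∃! _≡_ (λ e → e ∈ˢ M × Q e) → One (lookup M e₁) (lookup M e₂) (lookup M e₃)
  unique⇒One (e , (e∈ , q) , unique) with only q
  ... | inj₁ refl        = one ([]=⇒lookup e∈) (excluded unique inc₂ apart₁₂) (excluded unique inc₃ apart₁₃) one₁
  ... | inj₂ (inj₁ refl) = one (excluded unique inc₁ (apart₁₂ ∘ sym)) ([]=⇒lookup e∈) (excluded unique inc₃ apart₂₃) one₂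
  ... | inj₂ (inj₂ refl) = one (excluded unique inc₁ (apart₁₃ ∘ sym)) (excluded unique inc₂ (apart₂₃ ∘ sym)) ([]=⇒lookup e∈) one₃

  One⇒unique : One (lookup M e₁) (lookup M e₂) (lookup M e₃) → ∃! _≡_ (λ e → e ∈ˢ M × Q e)
  One⇒unique o with lookup M e₁ in eq₁ | lookup M e₂ in eq₂ | lookup M e₃ in eq₃
  One⇒unique one₁ | true | false | false = e₁ , (lookup⇒[]= e₁ M eq₁ , inc₁) , λ (y∈ , q) → case only q of λ where
    (inj₁ refl)        → refl
    (inj₂ (inj₁ refl)) → conflict y∈ eq₂
    (inj₂ (inj₂ refl)) → conflict y∈ eq₃
  One⇒unique one₂ | false | true | false = e₂ , (lookup⇒[]= e₂ M eq₂ , inc₂) , λ (y∈ , q) → case only q of λ where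
    (inj₁ refl)        → conflict y∈ eq₁
    (inj₂ (inj₁ refl)) → refl
    (inj₂ (inj₂ refl)) → conflict y∈ eq₃
  One⇒unique one₃ | false | false | true = e₃ , (lookup⇒[]= e₃ M eq₃ , inc₃) , λ (y∈ , q) → case only q of λ where
    (inj₁ refl)        → conflict y∈ eq₁
    (inj₂ (inj₁ refl)) → conflict y∈ eq₂
    (inj₂ (inj₂ refl)) → refl

select : Fin 3 → Label → Bool
select 0F = hop
select 1F = rung
select 2F = rim

⊑-select : ∀ o t → o ⊑ t → ∀ c → select c o ≡ true → select c t ≡ true
⊑-select ⟨ a , b , c ⟩ ⟨ a′ , b′ , c′ ⟩ h
  with h₀ , h ← to (T-∧ {a ⇒ᵇ a′}) h
  with h₁ , h₂ ← to (T-∧ {b ⇒ᵇ b′}) h = λ where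
    0F → implication h₀
    1F → implication h₁
    2F → implication h₂
  where
  implication : ∀ {a a′} → T (a ⇒ᵇ a′) → a ≡ true → a′ ≡ true
  implication {a′ = true} _ _ = refl
  implication {true} {false} ()

module _ {n : ℕ} .{{_ : NonZero n}} where

  lab-⊑⇒⊆ : ∀ {S M : EdgeSet (P n)} → (∀ k → lab S k ⊑ lab M k) → S ⊆ M
  lab-⊑⇒⊆ {S} {M} le {e} e∈ = lookup⇒[]= e M (lemma (edgeView e) ([]=⇒lookup e∈))
    where
    at-index : EdgeSet (P n) → Fin n → Label
    at-index M i = ⟨ lookup M (uu i) , lookup M (spoke i) , lookup M (vv i) ⟩
    selected : ∀ i c → select c (at-index S i) ≡ true → select c (at-index M i) ≡ true
    selected i = ⊑-select (at-index S i) (at-index M i)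
      (subst (λ j → at-index S j ⊑ at-index M j) (pos-toℕ i) (le (toℕ i)))
    lemma : ∀ {e} → EdgeView e → lookup S e ≡ true → lookup M e ≡ true
    lemma (is-uu i)    = selected i 0F
    lemma (is-spoke i) = selected i 1F
    lemma (is-vv i)    = selected i 2F

  pos-offset : ∀ r i → ∃ λ j → j < n × pos (j + r) ≡ i
  pos-offset r i with k , eq ← pos-surjective r i = toℕ (pos k) , toℕ<n (pos k) , (begin
    pos (toℕ (pos k) + r)   ≡⟨ cong pos (+-comm (toℕ (pos k)) r) ⟩
    pos (r + toℕ (pos k))   ≡⟨ pos-⊕ (toℕ (pos k)) r ⟨
    pos (toℕ (pos k)) ⊕ r   ≡⟨ cong (_⊕ r) (pos-toℕ (pos k)) ⟩
    pos k ⊕ r               ≡⟨ pos-⊕ k r ⟩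
    pos (r + k)             ≡⟨ eq ⟩
    i                       ∎)
    where open ≡-Reasoning

  seg-⊑*⇒⊆ : ∀ {S M : EdgeSet (P n)} r → seg (lab S) r n ⊑* seg (lab M) r n → S ⊆ M
  seg-⊑*⇒⊆ {S} {M} r p = lab-⊑⇒⊆ λ k → case pos-offset r (pos k) of λ where
    (j , j<n , eq) → subst₂ _⊑_ (lab-pos S eq) (lab-pos M eq) (seg-⊑*⁻ {lab S} {lab M} r n p j j<n)

  ⊑*-refl : ∀ {ts} → ts ⊑* ts
  ⊑*-refl = Pointwise.refl λ {t} → ⊑-refl t
    where
    ⊑-refl : ∀ t → t ⊑ t
    ⊑-refl ⟨ true  , true  , true  ⟩ = _
    ⊑-refl ⟨ true  , true  , false ⟩ = _
    ⊑-refl ⟨ true  , false , true  ⟩ = _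
    ⊑-refl ⟨ true  , false , false ⟩ = _
    ⊑-refl ⟨ false , true  , true  ⟩ = _
    ⊑-refl ⟨ false , true  , false ⟩ = _
    ⊑-refl ⟨ false , false , true  ⟩ = _
    ⊑-refl ⟨ false , false , false ⟩ = _

  seg-injective : ∀ {M M′ : EdgeSet (P n)} r → seg (lab M) r n ≡ seg (lab M′) r n → M ≡ M′
  seg-injective {M} {M′} r eq = ⊆-antisym
    (seg-⊑*⇒⊆ {M} {M′} r (subst (seg (lab M) r n ⊑*_) eq ⊑*-refl))
    (seg-⊑*⇒⊆ {M′} {M} r (subst (_⊑* seg (lab M) r n) eq ⊑*-refl))

  -- Modulo n, `r * pred n + toℕ i` is i - r, so that `ts` is laid out from subscript r onwards.
  placed : ℕ → List Label → Fin 3 × Fin n → Bool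
  placed r ts (c , i) = select c (nth ts (toℕ (pos (r * pred n + toℕ i))))

  place : ℕ → List Label → EdgeSet (P n)
  place r ts = tabulate (placed r ts ∘ remQuot {3} n)

  lookup-place : ∀ r ts c i → lookup (place r ts) (combine {3} c i) ≡ placed r ts (c , i)
  lookup-place r ts c i = trans (lookup∘tabulate (placed r ts ∘ remQuot {3} n) (combine {3} c i))
    (cong (placed r ts) (remQuot-combine {3} c i))

  lab-place : ∀ r ts k → lab (place r ts) k ≡ nth ts (toℕ (pos (r * pred n + toℕ (pos k))))
  lab-place r ts k = eta (lookup-place r ts 0F (pos k)) (lookup-place r ts 1F (pos k)) (lookup-place r ts 2F (pos k))
    where
    eta : ∀ {t a b c} → a ≡ hop t → b ≡ rung t → c ≡ rim t → ⟨ a , b , c ⟩ ≡ t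
    eta refl refl refl = refl

  seg-place : ∀ r ts → length ts ≡ n → seg (lab (place r ts)) r n ≡ ts
  seg-place r ts len = trans
    (seg-cong r 0 n λ j j<n → trans (lab-place r ts (j + r)) (cong (nth ts) (trans (index j j<n) (sym (+-identityʳ j)))))
    (subst (λ m → seg (nth ts) 0 m ≡ ts) len (seg-nth ts))
    where
    open ≡-Reasoning
    index : ∀ j → j < n → toℕ (pos (r * pred n + toℕ (pos (j + r)))) ≡ j
    index j j<n = begin
      toℕ (pos (r * pred n + toℕ (pos (j + r))))    ≡⟨ cong toℕ (pos-⊕ (toℕ (pos (j + r))) (r * pred n)) ⟨
      toℕ (pos (toℕ (pos (j + r))) ⊕ r * pred n)    ≡⟨ cong (λ i → toℕ (i ⊕ r * pred n)) (pos-toℕ (pos (j + r))) ⟩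
      toℕ (pos (j + r) ⊕ r * pred n)                ≡⟨ cong toℕ (pos-⊕ (j + r) (r * pred n)) ⟩
      toℕ (pos (r * pred n + (j + r)))              ≡⟨ cong (λ i → toℕ (pos (r * pred n + i))) (+-comm j r) ⟩
      toℕ (pos (r * pred n + (r + j)))              ≡⟨ cong toℕ (pos-back r j) ⟩
      toℕ (pos j)                                   ≡⟨ toℕ-pos j ⟩
      j % n                                         ≡⟨ m<n⇒m%n≡m j<n ⟩
      j                                             ∎

  ends-combine : ∀ c i → ends (P n) (combine {3} c i) ≡ endsP (c , i)
  ends-combine c i = cong endsP (remQuot-combine {3} c i)

  IsEnd : Vertex n → Fin 3 × Fin n → Set
  IsEnd x a = x ≡ proj₁ (endsP a) ⊎ x ≡ proj₂ (endsP a)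

  end⁺ : ∀ {x} c i → IsEnd x (c , i) → IsEndOf (P n) x (combine {3} c i)
  end⁺ {x} c i = subst (λ q → x ≡ proj₁ q ⊎ x ≡ proj₂ q) (sym (ends-combine c i))

  end⁻ : ∀ {x} c i → IsEndOf (P n) x (combine {3} c i) → IsEnd x (c , i)
  end⁻ {x} c i = subst (λ q → x ≡ proj₁ q ⊎ x ≡ proj₂ q) (ends-combine c i)

  pos-apart : ∀ c → 0 < c → c < n → ∀ k → pos k ≢ pos (c + k)
  pos-apart c 0<c c<n k e = <⇒≢ 0<c (begin
    0            ≡⟨ m<n⇒m%n≡m (<-trans 0<c c<n) ⟨
    0 % n        ≡⟨ toℕ-pos 0 ⟨
    toℕ (pos 0)  ≡⟨ cong toℕ (pos-cancel k (trans (cong pos (+-identityʳ k)) (trans e (cong pos (+-comm c k))))) ⟩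
    toℕ (pos c)  ≡⟨ toℕ-pos c ⟩
    c % n        ≡⟨ m<n⇒m%n≡m c<n ⟩
    c            ∎)
    where open ≡-Reasoning

  back-pos : ∀ c i k → i ⊕ c ≡ pos (c + k) → i ≡ pos k
  back-pos c i k e = trans (sym (pos-toℕ i)) (pos-cancel c (begin
    pos (c + toℕ i)   ≡⟨ pos-⊕ (toℕ i) c ⟨
    pos (toℕ i) ⊕ c   ≡⟨ cong (_⊕ c) (pos-toℕ i) ⟩
    i ⊕ c             ≡⟨ e ⟩
    pos (c + k)       ∎))
    where open ≡-Reasoning

  u-injective : ∀ {i j : Fin n} → u i ≡ u j → i ≡ j
  u-injective refl = refl

  v-injective : ∀ {i j : Fin n} → v i ≡ v j → i ≡ j
  v-injective refl = refl

  module _ (3≤n : 3 ≤ n) where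

    incident-u : ∀ k → Incident (IsEndOf (P n) (u (pos (2 + k)))) (uu (pos k)) (uu (pos (2 + k))) (spoke (pos (2 + k)))
    incident-u k = record
      { inc₁    = end⁺ 0F (pos k) (inj₂ (cong u (sym (pos-⊕ k 2))))
      ; inc₂    = end⁺ 0F (pos (2 + k)) (inj₁ refl)
      ; inc₃    = end⁺ 1F (pos (2 + k)) (inj₁ refl)
      ; only    = λ {e} → only (edgeView e)
      ; apart₁₂ = λ e → pos-apart 2 z<s 3≤n k (proj₂ (combine-injective {3} 0F (pos k) 0F (pos (2 + k)) e))
      ; apart₁₃ = λ e → case proj₁ (combine-injective {3} 0F (pos k) 1F (pos (2 + k)) e) of λ ()
      ; apart₂₃ = λ e → case proj₁ (combine-injective {3} 0F (pos (2 + k)) 1F (pos (2 + k)) e) of λ ()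
      }
      where
      only : ∀ {e} → EdgeView e → IsEndOf (P n) (u (pos (2 + k))) e →
        e ≡ uu (pos k) ⊎ e ≡ uu (pos (2 + k)) ⊎ e ≡ spoke (pos (2 + k))
      only (is-uu i) h with end⁻ 0F i h
      ... | inj₁ e = inj₂ (inj₁ (cong uu (sym (u-injective e))))
      ... | inj₂ e = inj₁ (cong uu (back-pos 2 i k (sym (u-injective e))))
      only (is-spoke i) h with end⁻ 1F i h
      ... | inj₁ e = inj₂ (inj₂ (cong spoke (sym (u-injective e))))
      only (is-vv i) h with end⁻ 2F i h
      ... | inj₁ ()
      ... | inj₂ ()

    incident-v : ∀ k → Incident (IsEndOf (P n) (v (pos (1 + k)))) (vv (pos k)) (vv (pos (1 + k))) (spoke (pos (1 + k)))
    incident-v k = record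
      { inc₁    = end⁺ 2F (pos k) (inj₂ (cong v (sym (pos-⊕ k 1))))
      ; inc₂    = end⁺ 2F (pos (1 + k)) (inj₁ refl)
      ; inc₃    = end⁺ 1F (pos (1 + k)) (inj₂ refl)
      ; only    = λ {e} → only (edgeView e)
      ; apart₁₂ = λ e → pos-apart 1 z<s (<⇒≤ 3≤n) k (proj₂ (combine-injective {3} 2F (pos k) 2F (pos (1 + k)) e))
      ; apart₁₃ = λ e → case proj₁ (combine-injective {3} 2F (pos k) 1F (pos (1 + k)) e) of λ ()
      ; apart₂₃ = λ e → case proj₁ (combine-injective {3} 2F (pos (1 + k)) 1F (pos (1 + k)) e) of λ ()
      }
      where
      only : ∀ {e} → EdgeView e → IsEndOf (P n) (v (pos (1 + k))) e →
        e ≡ vv (pos k) ⊎ e ≡ vv (pos (1 + k)) ⊎ e ≡ spoke (pos (1 + k))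
      only (is-uu i) h with end⁻ 0F i h
      ... | inj₁ ()
      ... | inj₂ ()
      only (is-spoke i) h with end⁻ 1F i h
      ... | inj₂ e = inj₂ (inj₂ (cong spoke (sym (v-injective e))))
      only (is-vv i) h with end⁻ 2F i h
      ... | inj₁ e = inj₂ (inj₁ (cong vv (sym (v-injective e))))
      ... | inj₂ e = inj₁ (cong vv (back-pos 1 i k (sym (v-injective e))))

    perfect⇒matching : ∀ {M} → IsPerfectMatching (P n) M → Matching (lab M)
    perfect⇒matching pm k =
      unique⇒One (incident-u k) (pm (u (pos (2 + k)))) , unique⇒One (incident-v (1 + k)) (pm (v (pos (2 + k))))

    matching⇒perfect : ∀ {M} → Matching (lab M) → IsPerfectMatching (P n) M
    matching⇒perfect {M} mt (u i) with k , refl ← pos-surjective 2 i = One⇒unique (incident-u k) (proj₁ (mt k))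
    matching⇒perfect {M} mt (v i) with k , refl ← pos-surjective 2 i = One⇒unique (incident-v (1 + k)) (proj₂ (mt k))

-- The matchings in 𝓜₂

open State

-- Without a spoke, u_i and v_i are covered forwards exactly when they are not covered backwards.
plain : ∀ {y t} → Legal y t → rung t ≡ ○ → next y t ≡ ⟪ hop₁ y , not (hop₂ y) , not (rim₁ y) ⟫
plain (one₁ , one₁) refl = refl
plain (one₁ , one₂) refl = refl
plain (one₂ , one₁) refl = refl
plain (one₂ , one₂) refl = refl

blocked : ∀ {y t} → Legal y t → T (hop₂ y ∨ rim₁ y) → rung t ≡ ○
blocked (one₁ , _)    _ = refl
blocked (one₂ , _)    _ = refl
blocked (one₃ , one₃) ()

spoked : ∀ {y t} → Legal y t → rung t ≡ ● → y ≡ ⟪ ○ , hop₁ y , ○ ⟫ × next y t ≡ ⟪ hop₁ y , ○ , ○ ⟫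
spoked (one₃ , one₃) refl = refl , refl

-- A parity which is constant along every walk. Just before a spoke the state is `home` or `origin`,
-- and the parity, true at `home` only, distinguishes the two.
odd : State → Bool
odd ⟪ p , q , r ⟫ = q xor (p xor r)

odd-next : ∀ {y t} → Legal y t → odd (next y t) ≡ odd y
odd-next {⟪ _ , true  , _ ⟫} (one₁ , one₁) = refl
odd-next {⟪ _ , false , _ ⟫} (one₁ , one₁) = refl
odd-next {⟪ _ , true  , _ ⟫} (one₁ , one₂) = refl
odd-next {⟪ _ , false , _ ⟫} (one₁ , one₂) = refl
odd-next {⟪ _ , true  , _ ⟫} (one₂ , one₁) = refl
odd-next {⟪ _ , false , _ ⟫} (one₂ , one₁) = refl
odd-next {⟪ _ , true  , _ ⟫} (one₂ , one₂) = refl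
odd-next {⟪ _ , false , _ ⟫} (one₂ , one₂) = refl
odd-next {⟪ _ , true  , _ ⟫} (one₃ , one₃) = refl
odd-next {⟪ _ , false , _ ⟫} (one₃ , one₃) = refl

∨-T : ∀ b → T (b ∨ true)
∨-T true  = _
∨-T false = _

module _ {x : ℕ → Label} (mt : Matching x) where

  plain-step : ∀ k {p q r} → st x k ≡ ⟪ p , q , r ⟫ → rung (x (2 + k)) ≡ ○ → st x (1 + k) ≡ ⟪ q , not p , not r ⟫
  plain-step k eq h = trans (plain (mt k) h) (cong (λ y → ⟪ hop₁ y , not (hop₂ y) , not (rim₁ y) ⟫) eq)

  blocked-step : ∀ k {p q r} → st x k ≡ ⟪ p , q , r ⟫ → T (p ∨ r) →
    rung (x (2 + k)) ≡ ○ × st x (1 + k) ≡ ⟪ q , not p , not r ⟫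
  blocked-step k eq t with h ← blocked {st x k} (mt k) (subst (λ y → T (hop₂ y ∨ rim₁ y)) (sym eq) t) = h , plain-step k eq h

  -- The map of `plain` has period four, and in each of the three states in between a backward edge
  -- blocks the spoke.
  four-steps : ∀ k {q} → st x k ≡ ⟪ ○ , q , ○ ⟫ → rung (x (2 + k)) ≡ ○ →
    rung (x (3 + k)) ≡ ○ × rung (x (4 + k)) ≡ ○ × rung (x (5 + k)) ≡ ○ × st x (4 + k) ≡ ⟪ ○ , q , ○ ⟫
  four-steps k {q} e₀ h₀
    with e₁ ← plain-step k e₀ h₀
    with h₁ , e₂ ← blocked-step (1 + k) e₁ (∨-T q)
    with h₂ , e₃ ← blocked-step (2 + k) e₂ _
    with h₃ , e₄ ← blocked-step (3 + k) e₃ (∨-T (not q))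
    = h₁ , h₂ , h₃ , trans e₄ (cong (λ b → ⟪ ○ , b , ○ ⟫) (not-involutive q))

  home-spoke : ∀ k → st x k ≡ home → rung (x (2 + k)) ≡ ● →
    rung (x (3 + k)) ≡ ○ × rung (x (4 + k)) ≡ ○ × st x (3 + k) ≡ home
  home-spoke k e₀ h₀
    with _ , e₁ ← spoked (mt k) h₀
    with h₁ , e₂ ← blocked-step (1 + k) (trans e₁ (cong (λ y → ⟪ hop₁ y , ○ , ○ ⟫) e₀)) _
    with h₂ , e₃ ← blocked-step (2 + k) e₂ _
    = h₁ , h₂ , e₃

  home-gap : ∀ d k → st x k ≡ home → (∀ c → c < d → rung (x (2 + (c + k))) ≡ ○) →
    rung (x (2 + (d + k))) ≡ ● → ∃ λ q → d ≡ q * 4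
  home-gap 0 k _ _ _ = 0 , refl
  home-gap 1 k e h s with h₁ , _ ← four-steps k e (h 0 z<s) = contradiction (trans (sym s) h₁) λ ()
  home-gap 2 k e h s with _ , h₂ , _ ← four-steps k e (h 0 z<s) = contradiction (trans (sym s) h₂) λ ()
  home-gap 3 k e h s with _ , _ , h₃ , _ ← four-steps k e (h 0 z<s) = contradiction (trans (sym s) h₃) λ ()
  home-gap (suc (suc (suc (suc d)))) k e h s with _ , _ , _ , e′ ← four-steps k e (h 0 z<s)
    with q , eq ← home-gap d (4 + k) e′
      (λ c c<d → subst (λ i → rung (x (2 + i)) ≡ ○) (sym (+-left-comm c 4 k)) (h (4 + c) (s<s (s<s (s<s (s<s c<d))))))
      (subst (λ i → rung (x (2 + i)) ≡ ●) (sym (+-left-comm d 4 k)) s)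
    = suc q , cong (4 +_) eq

  -- A spoke at `home` leads back to `home` in three steps without another spoke. The rest of the
  -- gap consists of spokeless rounds of four, so d = 3 + 4 q.
  spoke-gap : ∀ d k → st x k ≡ home → rung (x (2 + k)) ≡ ● → 1 ≤ d →
    (∀ c → 1 ≤ c → c < d → rung (x (2 + (c + k))) ≡ ○) → rung (x (2 + (d + k))) ≡ ● → (d ∸ 1) % 4 ≡ 2
  spoke-gap 1 k e r _ h s with h₁ , _ ← home-spoke k e r = contradiction (trans (sym s) h₁) λ ()
  spoke-gap 2 k e r _ h s with _ , h₂ , _ ← home-spoke k e r = contradiction (trans (sym s) h₂) λ ()
  spoke-gap (suc (suc (suc d))) k e r _ h s with _ , _ , e′ ← home-spoke k e r
    with q , refl ← home-gap d (3 + k) e′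
      (λ c c<d → subst (λ i → rung (x (2 + i)) ≡ ○) (sym (+-left-comm c 3 k)) (h (3 + c) (s≤s z≤n) (s<s (s<s (s<s c<d)))))
      (subst (λ i → rung (x (2 + i)) ≡ ●) (sym (+-left-comm d 3 k)) s)
    = [m+kn]%n≡m%n 2 q 4

  odd-+ : ∀ j k → odd (st x (j + k)) ≡ odd (st x k)
  odd-+ zero    k = refl
  odd-+ (suc j) k = trans (odd-next {st x (j + k)} {x (2 + (j + k))} (mt (j + k))) (odd-+ j k)

  spoke-home : ∀ k → odd (st x k) ≡ true → rung (x (2 + k)) ≡ ● → st x k ≡ home
  spoke-home k o r with e , _ ← spoked (mt k) r =
    trans e (cong (λ b → ⟪ ○ , b , ○ ⟫) (trans (sym (xor-false _)) (trans (sym (cong odd e)) o)))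
    where
    xor-false : ∀ b → b xor false ≡ b
    xor-false true  = refl
    xor-false false = refl

walk-end-st : ∀ {x y z} r m → 2 ≤ m → Walk y (seg x r m) z → ∃ λ k → st x k ≡ z
walk-end-st r 1                   (s≤s ())
walk-end-st r 2                   _ (_ ∷ _ ∷ []) = r , refl
walk-end-st r (suc (suc (suc m))) _ (_ ∷ w)      = walk-end-st (suc r) (2 + m) (s≤s (s≤s z≤n)) w

seg-any : ∀ {x} {Q : Label → Set} r m → Any Q (seg x r m) → ∃ λ k → Q (x k)
seg-any r (suc m) (here q)  = r , q
seg-any r (suc m) (there a) = seg-any (suc r) m a

plain-word : ∀ w {x} r m → seg x r m ≡ flatten w → (∀ j → rung (x j) ≡ ○) → w ≡ replicate (length w) L
plain-word []      r m _  _ = refl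
plain-word (A ∷ w) r (suc m) eq h = contradiction (trans (sym (h r)) (cong rung (∷-injectiveˡ eq))) λ ()
plain-word (L ∷ w) r (suc (suc (suc (suc m)))) eq h =
  cong (L ∷_) (plain-word w (4 + r) m (∷-injectiveʳ (∷-injectiveʳ (∷-injectiveʳ (∷-injectiveʳ eq)))) h)

module _ {n : ℕ} .{{_ : NonZero n}} where

  false⇒∉ : ∀ {e} {M : EdgeSet (P n)} → lookup M e ≡ false → e ∉ˢ M
  false⇒∉ eq e∈ = contradiction (trans (sym ([]=⇒lookup e∈)) eq) λ ()

  ∉⇒false : ∀ {e} {M : EdgeSet (P n)} → e ∉ˢ M → lookup M e ≡ false
  ∉⇒false {e} {M} e∉ with lookup M e in eq
  ... | true  = ⊥-elim (e∉ (lookup⇒[]= e M eq))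
  ... | false = refl

  pos-shift : ∀ c k → pos (2 + k) ⊕ c ≡ pos {n} (2 + (c + k))
  pos-shift c k = trans (pos-⊕ (2 + k) c) (cong pos (+-left-comm c 2 k))

  home-gaps : ∀ {M : EdgeSet (P n)} → Matching (lab M) → ∀ {k₀} → st (lab M) k₀ ≡ home →
    ∀ i d → ConsecutiveSpokes n M i d → (d ∸ 1) % 4 ≡ 2
  home-gaps {M} mt {k₀} e₀ i d (1≤d , _ , s , s′ , between) with k , refl ← pos-surjective 2 i =
    spoke-gap {lab M} mt d k (spoke-home {lab M} mt k (odd-st k) ([]=⇒lookup s)) ([]=⇒lookup s) 1≤d
      (λ c 1≤c c<d → ∉⇒false {M = M} (subst (λ j → spoke j ∉ˢ M) (pos-shift c k) (between c 1≤c c<d)))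
      ([]=⇒lookup (subst (λ j → spoke j ∈ˢ M) (pos-shift d k) s′))
    where
    open ≡-Reasoning
    x = lab M
    regroup : ∀ k₀ p k → k₀ * suc p + k ≡ k₀ * p + k + k₀
    regroup = solve-∀
    -- The parity is known at `k₀` and propagates forwards; `k₀` full turns bring any index past
    -- `k₀`.
    odd-st : ∀ k → odd (st x k) ≡ true
    odd-st k = begin
      odd (st x k)                          ≡⟨ cong odd (st-periodic-* {n} {x} (lab-periodic M) k₀ k) ⟨
      odd (st x (k₀ * n + k))               ≡⟨ cong (λ m → odd (st x (k₀ * m + k))) (suc-pred n) ⟨
      odd (st x (k₀ * suc (pred n) + k))    ≡⟨ cong (λ j → odd (st x j)) (regroup k₀ (pred n) k) ⟩
      odd (st x (k₀ * pred n + k + k₀))     ≡⟨ odd-+ {x} mt (k₀ * pred n + k) k₀ ⟩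
      odd (st x k₀)                         ≡⟨ cong odd e₀ ⟩
      true                                  ∎

  module _ {M : EdgeSet (P n)} (mt : Matching (lab M)) where

    private
      x = lab M

      1≤n : 1 ≤ n
      1≤n = subst (1 ≤_) (suc-pred n) (s≤s z≤n)

      NoSpokes : ℕ → ℕ → Set
      NoSpokes k d = ∀ c → 1 ≤ c → c < d → rung (x (2 + (c + k))) ≡ ○

      spoke-again : ∀ k → rung (x (2 + k)) ≡ ● → rung (x (2 + (n + k))) ≡ ●
      spoke-again k r = trans (cong rung (trans (cong x (+-left-comm 2 n k)) (lab-periodic M (2 + k)))) r

    module _ (gaps : ∀ i d → ConsecutiveSpokes n M i d → (d ∸ 1) % 4 ≡ 2) where

      -- Such a spoke would be consecutive to the one at `2 + k` with 4 j spokes between them. If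
      -- the distance exceeds n, the spoke at `2 + k` itself has already recurred at distance n.
      no-spoke : ∀ k → rung (x (2 + k)) ≡ ● → ∀ j → NoSpokes k (1 + j * 4) → rung (x (2 + (1 + j * 4 + k))) ≡ ○
      no-spoke k r j ns with rung (x (2 + (1 + j * 4 + k))) in s
      ... | false = refl
      ... | true with 1 + j * 4 ≤? n
      ...   | yes le = contradiction (trans (sym (m*n%n≡0 j 4)) (gaps (pos (2 + k)) (1 + j * 4)
        (s≤s z≤n , le , lookup⇒[]= _ M r ,
         subst (λ i → spoke i ∈ˢ M) (sym (pos-shift (1 + j * 4) k)) (lookup⇒[]= _ M s) ,
         λ c 1≤c c<d → subst (λ i → spoke i ∉ˢ M) (sym (pos-shift c k)) (false⇒∉ {M = M} (ns c 1≤c c<d))))) λ ()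
      ...   | no gt = contradiction (trans (sym (spoke-again k r)) (ns n 1≤n (≰⇒> gt))) λ ()

      -- The next spoke could only come after 1 + j * 4 steps, which gaps excludes; so
      -- there would be none at all, not even the same one again after n steps.
      origins : ∀ k → rung (x (2 + k)) ≡ ● → st x (1 + k) ≡ origin →
        ∀ j → st x (1 + j * 4 + k) ≡ origin × NoSpokes k (1 + j * 4)
      origins k r e zero = e , λ { (suc c) _ (s≤s ()) }
      origins k r e (suc j) with e₀ , ns ← origins k r e j with r₀ ← no-spoke k r j ns
        with r₁ , r₂ , r₃ , e₄ ← four-steps {x} mt (1 + j * 4 + k) e₀ r₀ = e₄ , ns′
        where
        ns″ : ∀ o → o < 4 → rung (x (2 + (o + (1 + j * 4) + k))) ≡ ○
        ns″ 0 _ = r₀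
        ns″ 1 _ = r₁
        ns″ 2 _ = r₂
        ns″ 3 _ = r₃
        ns″ (suc (suc (suc (suc o)))) (s<s (s<s (s<s (s<s ()))))
        ns′ : NoSpokes k (1 + suc j * 4)
        ns′ c 1≤c c<d with c <? 1 + j * 4
        ... | yes lt = ns c 1≤c lt
        ... | no ge = subst (λ c → rung (x (2 + (c + k))) ≡ ○) (m∸n+n≡m (≮⇒≥ ge))
          (ns″ (c ∸ (1 + j * 4)) (+-cancelʳ-< (1 + j * 4) _ _
            (≤-trans (s≤s (≤-reflexive (m∸n+n≡m (≮⇒≥ ge)))) (≤-trans c<d (≤-reflexive (sym (+-suc 4 (j * 4))))))))

      -- A spoke read at `origin` leads to `origin` again, and by `origins` no spoke would follow
      -- within n steps, although the same one recurs.
      gaps-home : ∀ k → rung (x (2 + k)) ≡ ● → st x k ≡ home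
      gaps-home k r with e , e′ ← spoked (mt k) r = by-cases (hop (x (1 + k))) refl
        where
        by-cases : ∀ b → hop (x (1 + k)) ≡ b → st x k ≡ home
        by-cases true  eq = trans e (cong (λ b → ⟪ ○ , b , ○ ⟫) eq)
        by-cases false eq = contradiction
          (trans (sym (spoke-again k r))
            (proj₂ (origins k r (trans e′ (cong (λ b → ⟪ b , ○ , ○ ⟫) eq)) n) n 1≤n (s≤s (m≤m*n n 4))))
          λ ()

    pattern-home : ∀ {y t} → Legal y t → hop₁ y ≡ true → hop t ≡ true → rim t ≡ true → y ≡ home
    pattern-home (one₂ , one₂) refl refl refl = refl

    𝓜₂-home : 4 ≤ n → SpokeGaps≡2mod4 n M ⊎ SpokelessPattern n M →
      ∃ λ k → st x k ≡ home × (rung (x (2 + k)) ≡ ● ⊎ (∀ j → rung (x j) ≡ ○))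
    𝓜₂-home _ (inj₁ ((i , s) , gaps)) with k , refl ← pos-surjective 2 i =
      k , gaps-home gaps k ([]=⇒lookup s) , inj₁ ([]=⇒lookup s)
    -- A block of the pattern based at i contains the first label of an L at subscript i + 1, hence
    -- the shift by one. Since 4 ≤ n, there is a block with number 0.
    𝓜₂-home 4≤n (inj₂ (spokeless , _ , i , pat)) with k , refl ← pos-surjective 1 i =
      k , pattern-home (mt k)
            ([]=⇒lookup (edge uu 0 (λ e → inj₁ e)))
            ([]=⇒lookup (edge uu 1 (λ e → inj₂ (inj₁ e))))
            ([]=⇒lookup (edge vv 1 (λ e → inj₂ (inj₂ (inj₁ e))))) ,
      inj₂ (λ j → ∉⇒false {M = M} (spokeless (pos j)))
      where
      edge : (f : Fin n → Edge (P n)) (c : ℕ) →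
        (∀ {e} → e ≡ f (pos (1 + k) ⊕ c) →
          e ≡ uu (pos (1 + k) ⊕ 0) ⊎ e ≡ uu (pos (1 + k) ⊕ 1) ⊎ e ≡ vv (pos (1 + k) ⊕ 1) ⊎ e ≡ vv (pos (1 + k) ⊕ 3)) →
        f (pos (c + (1 + k))) ∈ˢ M
      edge f c h = from (pat _) (0 , m≥n⇒m/n>0 4≤n , h (cong f (sym (pos-⊕ (1 + k) c))))

-- Forcing numbers

tail-check : ∀ r → T (check (tail r))
tail-check 0 = _
tail-check 1 = _
tail-check 2 = _
tail-check 3 = _
tail-check 4 = _
tail-check 5 = _
tail-check (suc (suc (suc (suc (suc (suc _)))))) = _

tail-spoke : ∀ r → T (any rung (flatten (tail r)))
tail-spoke 0 = _
tail-spoke 1 = _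
tail-spoke 2 = _
tail-spoke 3 = _
tail-spoke 4 = _
tail-spoke 5 = _
tail-spoke (suc (suc (suc (suc (suc (suc _)))))) = _

family-spoke : ∀ r q → Any (λ t → T (rung t)) (flatten (family (tail r) q))
family-spoke r zero    = Any.any⁻ rung _ (tail-spoke r)
family-spoke r (suc q) rewrite flatten-++ (family (tail r) q) LA = Any.++⁺ˡ (family-spoke r q)

family-sizes : ∀ m → ∃₂ λ r q → extent (family (tail r) q) ≡ 34 + m
family-sizes 0 = 6 , 4 , refl
family-sizes 1 = 0 , 4 , refl
family-sizes 2 = 1 , 3 , refl
family-sizes 3 = 2 , 4 , refl
family-sizes 4 = 3 , 4 , refl
family-sizes 5 = 4 , 4 , refl
family-sizes 6 = 5 , 0 , refl
family-sizes (suc (suc (suc (suc (suc (suc (suc m))))))) with r , q , eq ← family-sizes m =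
  r , suc q , trans (extent-++ (family (tail r) q) LA) (trans (cong (_+ 7) eq) (+-comm (34 + m) 7))

module _ (n : ℕ) (34≤n : 34 ≤ n) where

  private
    instance
      nonZero : NonZero n
      nonZero = >-nonZero (≤-trans (s≤s z≤n) 34≤n)

    ≤n : ∀ {m} → m ≤ 34 → m ≤ n
    ≤n le = ≤-trans le 34≤n

    1≤n : 1 ≤ n
    1≤n = ≤n (≤ᵇ⇒≤ 1 34 _)

    3≤n : 3 ≤ n
    3≤n = ≤n (≤ᵇ⇒≤ 3 34 _)

  lab-closed : ∀ M k → st (lab {n} M) (n + k) ≡ st (lab M) k
  lab-closed M k = trans (cong (λ m → st (lab M) (m + k)) (sym (*-identityˡ n)))
    (st-periodic-* {n} {lab M} (lab-periodic M) 1 k)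

  extent-seg : ∀ {x r w} → seg x r n ≡ flatten w → extent w ≡ n
  extent-seg {x} {r} eq = trans (sym (cong length eq)) (length-seg x r n)

  walk-perfect : ∀ {x ts} → length ts ≡ n → Walk x ts x → IsPerfectMatching (P n) (place {n} 0 ts)
  walk-perfect {x} {ts} len w = matching⇒perfect 3≤n
    (closed-matching {n} {lab (place {n} 0 ts)} (lab-periodic (place {n} 0 ts)) 1≤n
      (subst (λ us → Walk x us x) (sym (seg-place {n} 0 ts len)) w))

  word-certificate : ∀ w → extent w ≡ n → (∃ λ w′ → w ≡ A ∷ w′) ⊎ w ≡ replicate (length w) L → Certificate w
  word-certificate _ extent≡ (inj₁ ([] , refl)) =
    contradiction (≤-trans 34≤n (≤-reflexive (sym extent≡))) λ { (s≤s (s≤s (s≤s ()))) }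
  word-certificate _ _ (inj₁ (l ∷ w , refl)) = certificate-A (l ∷ w) λ ()
  word-certificate w extent≡ (inj₂ eq) rewrite eq with length w
  ... | k with 9 ≤? k
  ...   | yes 9≤k with j , refl ← m≤n⇒∃[o]m+o≡n 9≤k = certificate-Ls j
  -- At most eight letters L cover at most 32 subscripts.
  ...   | no 9≰k = contradiction
    (≤-trans 34≤n (≤-trans (≤-reflexive (trans (sym extent≡) (extent-Ls k))) (*-monoˡ-≤ 4 (≤-pred (≰⇒> 9≰k)))))
    λ h → contradiction (≤⇒≤ᵇ h) λ ()

  small-set : ∀ {M} k → Matching (lab M) → ∀ {w} → seg (lab M) (2 + k) n ≡ flatten w → Certificate w →
    ∃ λ S → IsForcingSet (P n) M S × ∣ S ∣ ≤ bound n
  small-set {M} k mt {w} eq (os , below , forces , cheap) =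
    S , (seg-⊑*⇒⊆ (2 + k) (subst₂ _⊑*_ (sym os≡) (sym eq) below) , unique) ,
    subst₂ _≤_ (sym (trans (∣∣-cost S (2 + k)) (cong cost os≡)))
      (cong bound (extent-seg {w = w} eq)) cheap
    where
    S : EdgeSet (P n)
    S = place {n} (2 + k) os
    os≡ : seg (lab S) (2 + k) n ≡ os
    os≡ = seg-place {n} (2 + k) os (trans (Pointwise.Pointwise-length below) (extent-seg {w = w} eq))
    unique : ∀ M′ → IsPerfectMatching (P n) M′ → S ⊆ M′ → M′ ≡ M
    unique M′ perfect S⊆M′ = seg-injective (2 + k) (trans
      (forces (st (lab M′) k) (seg (lab M′) (2 + k) n)
        (subst (Walk (st (lab M′) k) (seg (lab M′) (2 + k) n)) (lab-closed M′ k)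
          (matching-walk (perfect⇒matching 3≤n {M′} perfect) k n))
        (subst (_⊑* seg (lab M′) (2 + k) n) os≡ (seg-⊑* (2 + k) n (⊆⇒lab-⊑ S⊆M′))))
      (sym eq))

  -- The cycle is cut open at an index in state `home`, and at a spoke if there is one, so that the
  -- word begins with A or consists of L only.
  forcing-set : ∀ {M} → 𝓜₂ n M → ∃ λ S → IsForcingSet (P n) M S × ∣ S ∣ ≤ bound n
  forcing-set {M} (perfect , shape)
    with mt ← perfect⇒matching 3≤n {M} perfect
    with k , e , first ← 𝓜₂-home {M = M} mt (≤n (≤ᵇ⇒≤ 4 34 _)) shape
    with w , eq ← parse (subst₂ (λ y z → Walk y (seg (lab M) (2 + k) n) z) e
      (trans (lab-closed M k) e)
      (matching-walk mt k n))
    = small-set {M} k mt {w} eq (word-certificate w (extent-seg {w = w} eq) (start-of w eq first))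
    where
    start-of : ∀ {k} w → seg (lab M) (2 + k) n ≡ flatten w → rung (lab M (2 + k)) ≡ ● ⊎ (∀ j → rung (lab M j) ≡ ○) →
      (∃ λ w′ → w ≡ A ∷ w′) ⊎ w ≡ replicate (length w) L
    start-of {k} w eq (inj₂ h) = inj₂ (plain-word w {lab M} (2 + k) n eq h)
    start-of (A ∷ w) _ (inj₁ _) = inj₁ (w , refl)
    start-of {k} [] eq (inj₁ _) = contradiction (≤-trans 1≤n (≤-reflexive (sym (extent-seg {w = []} eq)))) λ ()
    start-of {k} (L ∷ w) eq (inj₁ r) = contradiction (trans (sym r) (cong rung (first-label n 1≤n eq))) λ ()
      where
      first-label : ∀ m → 1 ≤ m → ∀ {t ts} → seg (lab M) (2 + k) m ≡ t ∷ ts → lab M (2 + k) ≡ t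
      first-label (suc m) _ = ∷-injectiveˡ

  module _ (r q : ℕ) (extent≡ : extent (family (tail r) q) ≡ n) where

    private
      w : Word
      w = family (tail r) q

      M : EdgeSet (P n)
      M = place {n} 0 (flatten w)

      seg≡ : seg (lab M) 0 n ≡ flatten w
      seg≡ = seg-place {n} 0 (flatten w) extent≡

      closed : Walk home (seg (lab M) 0 n) home
      closed = subst (λ ts → Walk home ts home) (sym seg≡) (flatten-walk w)

      perfect : IsPerfectMatching (P n) M
      perfect = walk-perfect extent≡ (flatten-walk w)

    family-𝓜₂ : 𝓜₂ n M
    family-𝓜₂
      with k , e ← walk-end-st {lab M} 0 n (≤n (≤ᵇ⇒≤ 2 34 _)) closed
      with j , s ← seg-any {lab M} 0 n (subst (Any _) (sym seg≡) (family-spoke r q))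
      = perfect ,
        inj₁ ((pos j , lookup⇒[]= _ M (to T-≡ s)) , home-gaps {M = M} (perfect⇒matching 3≤n {M} perfect) e)

    -- Any closed walk containing `S` can be placed on the cycle as a perfect matching, which equals
    -- `M` because `S` is forcing. So the labels of `S` force the word.
    family-large : ∀ {S} → IsForcingSet (P n) M S → bound n ≤ ∣ S ∣
    family-large {S} (S⊆M , unique) = subst₂ _≤_ (cong bound extent≡) (sym (∣∣-cost S 0))
      (family-lower (tail r) q (tail-check r) (≤-trans (≤n (≤ᵇ⇒≤ 2 34 _)) (≤-reflexive (sym extent≡)))
        (subst (seg (lab S) 0 n ⊑*_) seg≡ (seg-⊑* 0 n (⊆⇒lab-⊑ S⊆M))) forces)
      where
      forces : Forces (flatten w) (seg (lab S) 0 n)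
      forces x us walk below = trans (sym us≡) (trans (cong (λ M → seg (lab M) 0 n) M′≡M) seg≡)
        where
        len : length us ≡ n
        len = trans (sym (Pointwise.Pointwise-length below)) (length-seg (lab S) 0 n)
        us≡ : seg (lab (place {n} 0 us)) 0 n ≡ us
        us≡ = seg-place {n} 0 us len
        M′≡M : place {n} 0 us ≡ M
        M′≡M = unique (place {n} 0 us) (walk-perfect len walk)
          (seg-⊑*⇒⊆ {S = S} {M = place {n} 0 us} 0 (subst (seg (lab S) 0 n ⊑*_) (sym us≡) below))

    -- The upper bound holds for all of `𝓜₂`, hence for this matching, where it meets the lower
    -- bound.
    family-forcing-number : IsForcingNumber (P n) M (bound n)
    family-forcing-number = attained (forcing-set family-𝓜₂) , λ { _ (_ , forcing , refl) → family-large forcing }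
      where
      attained : (∃ λ S → IsForcingSet (P n) M S × ∣ S ∣ ≤ bound n) → ∃ λ S → IsForcingSet (P n) M S × ∣ S ∣ ≡ bound n
      attained (S , forcing , small) = S , forcing , ≤-antisym small (family-large forcing)

family-exists : ∀ n → 34 ≤ n → ∃₂ λ r q → extent (family (tail r) q) ≡ n
family-exists n 34≤n = subst (λ n → ∃₂ λ r q → extent (family (tail r) q) ≡ n) (m+[n∸m]≡n 34≤n) (family-sizes (n ∸ 34))

theorem4p1 : ∀ (n : ℕ) → 34 ≤ n →
    IsMaximum (λ m → ∃ λ (M : EdgeSet (P n)) → 𝓜₂ n M × IsForcingNumber (P n) M m)
    (⌈ (n + 3) / 7 ⌉ + δ n)
theorem4p1 n 34≤n = attained (family-exists n 34≤n) , λ k (M , M∈ , _ , least) → at-most (forcing-set n 34≤n M∈) least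
  where
  attained : (∃₂ λ r q → extent (family (tail r) q) ≡ n) →
    ∃ λ M → 𝓜₂ n M × IsForcingNumber (P n) M (bound n)
  attained (r , q , eq) = _ , family-𝓜₂ n 34≤n r q eq , family-forcing-number n 34≤n r q eq
  at-most : ∀ {M : EdgeSet (P n)} {k} → (∃ λ S → IsForcingSet (P n) M S × ∣ S ∣ ≤ bound n) →
    (∀ j → (∃ λ S → IsForcingSet (P n) M S × ∣ S ∣ ≡ j) → k ≤ j) → k ≤ bound n
  at-most (S , forcing , small) least = ≤-trans (least ∣ S ∣ (S , forcing , refl)) small
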